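{- Let $G$ be a unicyclic graph with cycle $(v_0,\dots,v_{g-1})$, cycle edges $c_j=\{v_{j-1},v_j\}$ (indices mod $g$), in the balanced regime. Then the eigenvalue problem $R_Gz=\lambda z$ of the Ricci matrix $R_G$ decouples from the pendant trees, as follows. (1) Each pendant tree $B_v$ hanging off the cycle contributes, through a Schur complement (elimination of the coordinates of $z$ on the edges of $B_v$), a single scalar correction to the cycle diagonal at its attachment vertex $v$. This correction is the feedback $\Psi_v(\lambda)$, given explicitly by the continued fraction in the spectral parameter $\lambda$ written in the context: if $c,c'$ are the two cycle edges at $v$, the sum $\sigma_v$ of the coordinates of $z$ over the pendant edges incident to $v$ equals $\Psi_v(\lambda)(z_c+z_{c'})$. (2) What remains is a periodic eigenvalue problem along the cycle, for the cycle coordinates $z_j=z_{c_j}$: $$P_jz_{j+1}=Q_jz_j-P_{j-1}z_{j-1},\qquad P_j=\frac{1+\Psi_{v_j}(\lambda)}{d_{v_j}},\qquad Q_j=\lambda+\frac{1-\Psi_{v_{j-1}}(\lambda)}{d_{v_{j-1}}}+\frac{1-\Psi_{v_j}(\lambda)}{d_{v_j}}.$$ (3) Encode one step around the cycle as the $2\times2$ transfer matrix $T_j(\lambda)=\begin{pmatrix}Q_j/P_j&-P_{j-1}/P_j\\1&0\end{pmatrix}$. A real $\lambda$ that avoids the pendant-tree spectra (that is, $\lambda\notin\bigcup_v\sigma(R_{B_v})$) is an eigenvalue of $R_G$ with eigenvector supported on the cycle if and only if the ordered product of the $g$ transfer matrices around the cycle has trace exactly $2$: $$\operatorname{tr}\big(T_g(\lambda)\cdots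 T_1(\lambda)\big)=2.$$
   Context: Unicyclic: a finite connected graph with $|E|=|V|$; it is a cycle of girth $g\ge3$ with rooted trees (possibly trivial) attached at cycle vertices. $B_v$ is the tree hanging off the cycle vertex $v$, rooted at $v$; a pendant edge is any edge not on the cycle. $d_v$ is the degree of $v$ in $G$. Ricci matrix: $R_G\in\mathbb{R}^{E\times E}$ has diagonal entries $-(1/d_x+1/d_y)$ for $e=\{x,y\}$, entry $1/d_z$ for $e\neq e'$ with $e\cap e'=\{z\}$, and $0$ for disjoint edges. $R_{B_v}$ is the block of $R_G$ indexed by the edges of $B_v$, and $\sigma(R_{B_v})$ is its spectrum. Balanced regime: with $w^\ast>0$ the Perron eigenvector of $R_G$ (the positive eigenvector for the largest eigenvalue) and $L=\sum_jw^\ast(c_j)$, one has $w^\ast(c_{j-1})+w^\ast(c_j)+w^\ast(c_{j+1})\le L/2$ for every $j$. Feedback $\Psi_v$: orient $B_v$ away from $v$. For a leaf $u$ set $h_u=0$. For an internal vertex $u\ne v$ of $B_v$ set $$h_u=\frac{\beta_u}{1-\beta_u},\qquad \beta_u=\sum_{s\text{ child of }u}\frac{1}{d_u\lambda+2+d_u(1-h_s)/d_s}.$$ Then $$\Psi_v(\lambda)=\frac{\gamma_v}{1-\gamma_v},\qquad \gamma_v=\sum_u\frac{1}{d_v\lambda+2+d_v(1-h_u)/d_u},$$ with $u$ running over the children of $v$ in $B_v$ (so $\Psi_v=0$ if $B_v$ has no edges). These are rational functions of $\lambda$.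
   Formalization: In (3), "eigenvector supported on the cycle" is taken as not vanishing identically on the cycle edges (the literal reading fails at the Perron eigenvalue), with all P_j ≠ 0 so that T_j is defined; (1) and (2) are for λ off the tree spectra, where the Schur complements exist. -}

module Defs where

open import Algebra.Bundles using (CommutativeRing)
open import Algebra.Definitions.RawMonoid using () renaming (_×_ to multiple)
open import Algebra.Properties.Semiring.Sum using ()
open import Algebra.Structures using (IsCommutativeRing)
open import Data.Fin.Base using (Fin)
open import Data.Fin.Properties using (_≟_; any?)
open import Data.Bool.Base using (if_then_else_)
open import Data.List.Base using (List; []; _∷_; [_]; map; length; filter; allFin)
open import Data.Nat.Base as ℕ using (ℕ; zero; suc; NonZero; >-nonZero; z≤n; s≤s)
open import Data.Nat.DivMod using (_mod_)
open import Data.Nat.Properties using (≤-trans)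
open import Data.Product.Base using (∃; ∃-syntax; _×_)
open import Data.Sum.Base using (_⊎_)
open import Data.Unit.Base using (⊤)
open import Data.Vec.Functional as Vector using (Vector)
open import Function.Definitions using (Injective)
open import Level using (0ℓ)
open import Relation.Binary.Construct.Closure.ReflexiveTransitive using (Star)
open import Relation.Binary.PropositionalEquality.Core using (_≡_; _≢_)
open import Relation.Binary.Structures using (IsDecTotalOrder)
open import Relation.Nullary using (Dec; does; ¬_; ¬?; _×-dec_; _⊎-dec_)
open import Relation.Unary using (Pred; Decidable)

-- The real numbers, axiomatised classically as a Dedekind-complete ordered
-- field; these axioms determine ℝ up to isomorphism.
record Reals : Set₁ where
  infix  8 _⁻¹
  infixl 7 _*_
  infixl 6 _+_
  infix  4 _≈_ _≤_
  field
    Carrier           : Set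
    _≈_ _≤_           : Carrier → Carrier → Set
    _+_ _*_           : Carrier → Carrier → Carrier
    -_ _⁻¹            : Carrier → Carrier
    0# 1#             : Carrier
    isCommutativeRing : IsCommutativeRing _≈_ _+_ _*_ -_ 0# 1#
    isDecTotalOrder   : IsDecTotalOrder _≈_ _≤_
    0≉1               : ¬ (0# ≈ 1#)
    ⁻¹-cong           : ∀ {x y} → x ≈ y → x ⁻¹ ≈ y ⁻¹
    -- The inverse is total, but nothing is assumed about the value of 0# ⁻¹.
    ⁻¹-inverseʳ       : ∀ x → ¬ (x ≈ 0#) → x * x ⁻¹ ≈ 1#
    +-monoˡ-≤         : ∀ z {x y} → x ≤ y → x + z ≤ y + z
    *-nonNegative     : ∀ {x y} → 0# ≤ x → 0# ≤ y → 0# ≤ x * y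
    supremum          : (P : Carrier → Set) → ∃ P →
                        (∃[ b ] (∀ x → P x → x ≤ b)) →
                        ∃[ s ] (∀ x → P x → x ≤ s) ×
                               (∀ b → (∀ x → P x → x ≤ b) → s ≤ b)

  commutativeRing : CommutativeRing 0ℓ 0ℓ
  commutativeRing = record { isCommutativeRing = isCommutativeRing }

  open CommutativeRing commutativeRing public
    using (semiring; +-rawMonoid; _≉_; _-_)
  open Algebra.Properties.Semiring.Sum semiring public
    using (sum; sum-syntax)

  infix  4 _<_
  infixl 7 _÷_

  _<_ : Carrier → Carrier → Set
  x < y = x ≤ y × x ≉ y

  _÷_ : Carrier → Carrier → Carrier
  x ÷ y = x * y ⁻¹

  fromℕ : ℕ → Carrier
  fromℕ n = multiple +-rawMonoid n 1#

-- Finite simple graphs.  Edges are indexed, so that vectors and matrices over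
-- the edge set are functions on Fin size; src and tgt record the endpoints in
-- an order that carries no meaning.
record Graph : Set where
  field
    order size : ℕ

  V : Set
  V = Fin order

  E : Set
  E = Fin size

  field
    src tgt : E → V

  infix 4 _∈ₑ_ _∈ₑ?_

  _∈ₑ_ : V → E → Set
  x ∈ₑ e = x ≡ src e ⊎ x ≡ tgt e

  _∈ₑ?_ : ∀ x e → Dec (x ∈ₑ e)
  x ∈ₑ? e = (x ≟ src e) ⊎-dec (x ≟ tgt e)

  field
    loopless : ∀ e → src e ≢ tgt e
    simple   : ∀ e e′ → (∀ x → x ∈ₑ e → x ∈ₑ e′) → e ≡ e′

  Joins : E → V → V → Set
  Joins e x y = (src e ≡ x × tgt e ≡ y) ⊎ (src e ≡ y × tgt e ≡ x)

  Walk : Pred E 0ℓ → V → V → Set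
  Walk P = Star (λ x y → ∃[ e ] P e × Joins e x y)

  Connected : Set
  Connected = ∀ x y → Walk (λ _ → ⊤) x y

  degree : V → ℕ
  degree x = length (filter (x ∈ₑ?_) (allFin size))

  -- The endpoint of e other than its endpoint x.
  opposite : E → V → V
  opposite e x = if does (src e ≟ x) then tgt e else src e

-- A unicyclic graph together with its cycle (v₀, …, v_{g-1}) and the cycle
-- edges c_j = {v_{j-1}, v_j}.
record Unicyclic : Set where
  field
    graph : Graph
  open Graph graph public
  field
    connected : Connected
    |E|≡|V|   : size ≡ order
    g         : ℕ
    g≥3       : 3 ℕ.≤ g

  instance
    g-nonZero : NonZero g
    g-nonZero = >-nonZero (≤-trans (s≤s z≤n) g≥3)

  infix 9 _⟨_⟩

  -- Indices mod g.
  _⟨_⟩ : ∀ {a} {A : Set a} → (Fin g → A) → ℕ → A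
  f ⟨ k ⟩ = f (k mod g)

  field
    v           : Fin g → V
    v-injective : Injective _≡_ _≡_ v
    c           : Fin g → E
    c-joins     : ∀ k → Joins (c ⟨ suc k ⟩) (v ⟨ k ⟩) (v ⟨ suc k ⟩)

  Pendant : Pred E 0ℓ
  Pendant e = ¬ (∃[ j ] c j ≡ e)

  pendant? : Decidable Pendant
  pendant? e = ¬? (any? λ j → c j ≟ e)

  -- The edges of B_{v_j}, the component of v_j once the cycle edges are removed.
  InTree : Fin g → Pred E 0ℓ
  InTree j e = Pendant e × (∃[ x ] x ∈ₑ e × Walk Pendant (v j) x)

  PendantAt : V → Pred E 0ℓ
  PendantAt x e = Pendant e × x ∈ₑ e

  pendantAt? : ∀ x → Decidable (PendantAt x)
  pendantAt? x e = pendant? e ×-dec (x ∈ₑ? e)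

module LinearAlgebra (ℝ : Reals) where
  open Reals ℝ

  Matrix : ℕ → Set
  Matrix n = Fin n → Fin n → Carrier

  identity : ∀ {n} → Matrix n
  identity i j = if does (i ≟ j) then 1# else 0#

  infixl 7 _⊗_ _·_

  _⊗_ : ∀ {n} → Matrix n → Matrix n → Matrix n
  _⊗_ {n} M N i j = ∑[ k < n ] (M i k * N k j)

  _·_ : ∀ {n} → Matrix n → Vector Carrier n → Vector Carrier n
  _·_ {n} M z i = ∑[ k < n ] (M i k * z k)

  trace : ∀ {n} → Matrix n → Carrier
  trace {n} M = ∑[ i < n ] M i i

  SolvesOn : ∀ {n} → Pred (Fin n) 0ℓ → Matrix n → Carrier → Vector Carrier n → Set
  SolvesOn P M μ z = ∀ i → P i → (M · z) i ≈ μ * z i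

  Solves : ∀ {n} → Matrix n → Carrier → Vector Carrier n → Set
  Solves = SolvesOn (λ _ → ⊤)

  Eigenvalue : ∀ {n} → Matrix n → Carrier → Set
  Eigenvalue M μ = ∃[ z ] (∃[ i ] z i ≉ 0#) × Solves M μ z

  -- μ lies in the spectrum of the principal block of M indexed by P.  Vectors
  -- on P are represented by their extension by zero, on which M acts in the
  -- rows belonging to P exactly as the block does.
  BlockEigenvalue : ∀ {n} → Pred (Fin n) 0ℓ → Matrix n → Carrier → Set
  BlockEigenvalue P M μ =
    ∃[ z ] (∃[ i ] z i ≉ 0#) × (∀ i → ¬ P i → z i ≈ 0#) × SolvesOn P M μ z

module RationalFunctions (ℝ : Reals) where
  open Reals ℝ

  -- Coefficients, constant term first.
  Poly : Set
  Poly = List Carrier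

  ⟦_⟧ : Poly → Carrier → Carrier
  ⟦ []    ⟧ t = 0#
  ⟦ a ∷ p ⟧ t = a + t * ⟦ p ⟧ t

  infixl 6 _+ₚ_
  infixl 7 _*ₚ_

  _+ₚ_ : Poly → Poly → Poly
  []      +ₚ q       = q
  (a ∷ p) +ₚ []      = a ∷ p
  (a ∷ p) +ₚ (b ∷ q) = (a + b) ∷ (p +ₚ q)

  _*ₚ_ : Poly → Poly → Poly
  []      *ₚ q = []
  (a ∷ p) *ₚ q = map (a *_) q +ₚ (0# ∷ p *ₚ q)

  -ₚ_ : Poly → Poly
  -ₚ_ = map (-_)

  infix 4 _/_

  -- Formal fractions.  A zero denominator marks an undefined fraction.
  record Frac : Set where
    constructor _/_
    field
      num den : Poly
  open Frac public

  const : Carrier → Frac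
  const a = [ a ] / [ 1# ]

  var : Frac
  var = (0# ∷ 1# ∷ []) / [ 1# ]

  infixl 6 _+ᶠ_ _-ᶠ_
  infixl 7 _*ᶠ_ _÷ᶠ_

  _+ᶠ_ _-ᶠ_ _*ᶠ_ _÷ᶠ_ : Frac → Frac → Frac
  (a / b) +ᶠ (c / d) = a *ₚ d +ₚ c *ₚ b / b *ₚ d
  (a / b) -ᶠ (c / d) = a *ₚ d +ₚ (-ₚ (c *ₚ b)) / b *ₚ d
  (a / b) *ᶠ (c / d) = a *ₚ c / b *ₚ d
  -- The common factor d keeps the denominator zero when that of the divisor
  -- is.  Hence the denominator of a compound expression is nonzero only if no
  -- intermediate step has divided by the zero function.
  (a / b) ÷ᶠ (c / d) = a *ₚ (d *ₚ d) / b *ₚ (c *ₚ d)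

  sumᶠ : ∀ {n} → Vector Frac n → Frac
  sumᶠ = Vector.foldr _+ᶠ_ (const 0#)

  -- The rational function f is regular at μ with value x: some representation
  -- num / den of f has a nonvanishing denominator at μ.  Removable zeros of
  -- the given denominator of f are thus allowed.  Identities of polynomials are
  -- stated pointwise, which over an infinite field amounts to equality of
  -- coefficients.
  record _HasValue_At_ (f : Frac) (x μ : Carrier) : Set where
    field
      defined     : ∃[ t ] ⟦ den f ⟧ t ≉ 0#
      rep         : Frac
      represents  : ∀ t → ⟦ num rep ⟧ t * ⟦ den f ⟧ t ≈ ⟦ num f ⟧ t * ⟦ den rep ⟧ t
      regular     : ⟦ den rep ⟧ μ ≉ 0#
      value       : x ≈ ⟦ num rep ⟧ μ ÷ ⟦ den rep ⟧ μ

module Ricci (ℝ : Reals) (G : Unicyclic) where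
  open Reals ℝ
  open Unicyclic G
  open LinearAlgebra ℝ public
  open RationalFunctions ℝ public

  d : V → Carrier
  d x = fromℕ (degree x)

  -- As the graph is simple, the sum off the diagonal has at most one nonzero
  -- term, coming from the common endpoint of e and e′ if there is one.
  ricci : Matrix size
  ricci e e′ =
    if does (e ≟ e′)
    then - (1# ÷ d (src e) + 1# ÷ d (tgt e))
    else (∑[ x < order ] (if does ((x ∈ₑ? e) ×-dec (x ∈ₑ? e′)) then 1# ÷ d x else 0#))

  record Balanced : Set where
    field
      w        : Vector Carrier size
      ρ        : Carrier
      positive : ∀ e → 0# < w e
      eigen    : Solves ricci ρ w
      largest  : ∀ μ → Eigenvalue ricci μ → μ ≤ ρ

    L : Carrier
    L = ∑[ j < g ] w (c j)

    field
      balanced : ∀ k → w (c ⟨ k ⟩) + w (c ⟨ suc k ⟩) + w (c ⟨ suc (suc k) ⟩) ≤ L ÷ fromℕ 2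

  constℕ : ℕ → Frac
  constℕ n = const (fromℕ n)

  -- 1 / (d_u λ + 2 + d_u (1 - h) / d_s)
  term : (u s : V) (h : Frac) → Frac
  term u s h =
    constℕ 1 ÷ᶠ
    (const (d u) *ᶠ var +ᶠ constℕ 2 +ᶠ const (d u) *ᶠ (constℕ 1 -ᶠ h) ÷ᶠ const (d s))

  -- h n e u is h_u for a tree vertex u whose edge towards the root is e: the
  -- children of u are the far ends of the other pendant edges at u.  At a leaf
  -- the sum is empty and h_u = 0.  The number n bounds the depth of the
  -- recursion; the first clause is never reached from feedback, since a path
  -- leaving the root of a tree uses fewer than size edges.
  h : ℕ → E → V → Frac
  h zero    e u = constℕ 0
  h (suc n) e u = β ÷ᶠ (constℕ 1 -ᶠ β)
    where
    β : Frac
    β = sumᶠ λ e′ →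
      if does (pendantAt? u e′ ×-dec ¬? (e ≟ e′))
      then term u (opposite e′ u) (h n e′ (opposite e′ u))
      else constℕ 0

  γ : V → Frac
  γ x = sumᶠ λ e →
    if does (pendantAt? x e)
    then term x (opposite e x) (h size e (opposite e x))
    else constℕ 0

  -- Ψ at the cycle vertex v_j.
  feedback : Fin g → Frac
  feedback j = γ (v j) ÷ᶠ (constℕ 1 -ᶠ γ (v j))

  σ : Vector Carrier size → V → Carrier
  σ z x = ∑[ e < size ] (if does (pendantAt? x e) then z e else 0#)

  AvoidsTree : Fin g → Carrier → Set
  AvoidsTree j μ = ¬ BlockEigenvalue (InTree j) ricci μ

  -- The coordinates on the edges of B_{v_j} can be eliminated from the rows of
  -- ricci belonging to that tree: all other coordinates being given, these rows
  -- have exactly one solution.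
  Eliminates : Fin g → Carrier → Set
  Eliminates j μ = ∀ y → ∃[ z ]
    Extension y z × (∀ z′ → Extension y z′ → ∀ e → z′ e ≈ z e)
    where
    Extension : (y z : Vector Carrier size) → Set
    Extension y z = (∀ e → ¬ InTree j e → z e ≈ y e) × SolvesOn (InTree j) ricci μ z

  module Cycle (μ : Carrier) (Ψ : Fin g → Carrier) where

    P : ℕ → Carrier
    P k = (1# + Ψ ⟨ k ⟩) ÷ d (v ⟨ k ⟩)

    -- Q₊ k is Q_{k+1}; with indices mod g, this shift avoids writing k - 1.
    Q₊ : ℕ → Carrier
    Q₊ k = μ + (1# - Ψ ⟨ k ⟩) ÷ d (v ⟨ k ⟩) + (1# - Ψ ⟨ suc k ⟩) ÷ d (v ⟨ suc k ⟩)

    Periodic : (Fin g → Carrier) → Set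
    Periodic y = ∀ k →
      P (suc k) * y ⟨ suc (suc k) ⟩ ≈ Q₊ k * y ⟨ suc k ⟩ - P k * y ⟨ k ⟩

    -- T₊ k is T_{k+1}.
    T₊ : ℕ → Matrix 2
    T₊ k = ((Q₊ k ÷ P (suc k)) ∷ᵥ (- (P k ÷ P (suc k))) ∷ᵥ []ᵥ)
        ∷ᵥ (1#                 ∷ᵥ 0#                    ∷ᵥ []ᵥ)
        ∷ᵥ []ᵥ
      where open Vector using () renaming (_∷_ to _∷ᵥ_; [] to []ᵥ)

    -- T_n ⋯ T_1
    transfer : ℕ → Matrix 2
    transfer zero    = identity
    transfer (suc n) = T₊ n ⊗ transfer n

{-# OPTIONS --safe #-}
module Submission where

-- Because |E| = |V|, sending v_j to c_j and any other vertex to the first edge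
-- of a shortest path to the cycle is a bijection V → E; hence the pendant edges
-- form trees rooted on the cycle.  With S_x the sum of z over the edges at x,
-- row {x , y} of R_G z = t z reads S_x/d_x + S_y/d_y = (t + 2/d_x + 2/d_y) z_e.
-- Going down the recursion for Ψ_v = num/den, these rows give
-- den(t) σ_v = num(t) (z_c + z_c′) at every t, without any division.  Gaussian
-- elimination over the rational functions regular at μ solves the rows of a
-- tree by x(t)/δ(t) with δ(μ) ≠ 0, so σ_v(x)/δ represents Ψ_v near μ even
-- where the continued fraction itself breaks down.  Substituting
-- S_v = (1 + Ψ_v)(z_c + z_c′) in the cycle rows leaves the periodic recurrence;
-- the determinant of its monodromy M telescopes to P_0 / P_g = 1, so
-- det (M - 1) = 2 - tr M.

open import Algebra.Bundles using (CommutativeRing)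
import Algebra.Properties.Ring
import Algebra.Properties.Semiring.Mult.TCOptimised
import Algebra.Properties.Semiring.Sum
import Algebra.Solver.Ring
open import Algebra.Solver.Ring.AlmostCommutativeRing using (fromCommutativeRing; _-Raw-AlmostCommutative⟶_)
open import Data.Bool.Base using (Bool; true; false; if_then_else_; _∧_)
open import Data.Fin.Base using (Fin; zero; suc; toℕ; punchIn; punchOut)
open import Data.Fin.Patterns using (0F; 1F)
open import Data.Fin.Properties
  using (_≟_; any?; toℕ-injective; toℕ-fromℕ<; toℕ<n; pigeonhole; injective⇒≤; punchIn-punchOut; punchOut-injective)
open import Data.Integer.Base as ℤ using (ℤ; +_; -[1+_]; _⊖_)
import Data.Integer.Properties as ℤₚ
open import Data.List.Base using ([]; _∷_; [_]; map)
open import Data.List.Membership.Propositional using (lose)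
open import Data.List.Membership.Propositional.Properties using (∈-allFin)
open import Data.List.Properties using (filter-some)
open import Data.Maybe.Base using (Maybe; just; nothing)
open import Data.Nat.Base as ℕ using (ℕ; zero; suc; z≤n; s≤s; z<s)
open import Data.Nat.DivMod using (_mod_; _%_; m≡m%n+[m/n]*n; [m+kn]%n≡m%n; [m+n]%n≡m%n; m<n⇒m%n≡m; m%n<n; %-distribˡ-+)
import Data.Nat.Properties as ℕₚ
open import Data.Product.Base using (_,_; proj₁; proj₂; _×_; ∃-syntax; Σ-syntax)
open import Data.Sum.Base using (_⊎_; inj₁; inj₂; [_,_]′)
open import Data.Vec.Functional as Vector using (Vector)
open import Defs
open import Function.Base using (_∘_)
open import Function.Bundles using (_⇔_; mk⇔)
open import Function.Definitions using (Injective)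
open import Relation.Binary.Construct.Closure.ReflexiveTransitive using (_◅_; _◅◅_) renaming (ε to nil)
open import Relation.Binary.PropositionalEquality as ≡ using (_≡_; _≢_)
import Relation.Binary.Reasoning.Setoid
open import Relation.Binary.Structures using (IsDecTotalOrder)
open import Relation.Nullary using (Dec; yes; no; ¬_; ¬?; _×-dec_; _⊎-dec_; does; contradiction)
open import Relation.Nullary.Decidable using (map′; dec-true; dec-false)
open import Relation.Unary using (Pred; Decidable)

-- Ordered field arithmetic

module IntegerSolver (ℝ : Reals) where
  open CommutativeRing (Reals.commutativeRing ℝ)
  open Algebra.Properties.Ring ring
  open Algebra.Properties.Semiring.Mult.TCOptimised semiring renaming (_×_ to _•_)
  open Relation.Binary.Reasoning.Setoid setoid

  ⟦_⟧ℤ : ℤ → Carrier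
  ⟦ + n      ⟧ℤ = n • 1#
  ⟦ -[1+ n ] ⟧ℤ = - (suc n • 1#)

  -‿homo : ∀ i → ⟦ ℤ.- i ⟧ℤ ≈ - ⟦ i ⟧ℤ
  -‿homo (+ zero)  = sym -0#≈0#
  -‿homo (+ suc n) = refl
  -‿homo -[1+ n ]  = sym (-‿involutive _)

  ⊖-homo : ∀ m n → ⟦ m ⊖ n ⟧ℤ ≈ m • 1# + - (n • 1#)
  ⊖-homo m n with ℕₚ.≤-total n m
  ... | inj₁ n≤m = begin
    ⟦ m ⊖ n ⟧ℤ                                  ≡⟨ ≡.cong ⟦_⟧ℤ (ℤₚ.⊖-≥ n≤m) ⟩
    (m ℕ.∸ n) • 1#                              ≈⟨ +-identityʳ _ ⟨
    (m ℕ.∸ n) • 1# + 0#                         ≈⟨ +-congˡ (-‿inverseʳ _) ⟨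
    (m ℕ.∸ n) • 1# + (n • 1# + - (n • 1#))      ≈⟨ +-assoc _ _ _ ⟨
    (m ℕ.∸ n) • 1# + n • 1# + - (n • 1#)        ≈⟨ +-congʳ (×-homo-+ 1# (m ℕ.∸ n) n) ⟨
    (m ℕ.∸ n ℕ.+ n) • 1# + - (n • 1#)           ≡⟨ ≡.cong (λ k → k • 1# + _) (ℕₚ.m∸n+n≡m n≤m) ⟩
    m • 1# + - (n • 1#)                         ∎
  ... | inj₂ m≤n = begin
    ⟦ m ⊖ n ⟧ℤ                                  ≡⟨ ≡.cong ⟦_⟧ℤ (ℤₚ.⊖-≤ m≤n) ⟩
    ⟦ ℤ.- + (n ℕ.∸ m) ⟧ℤ                        ≈⟨ -‿homo (+ (n ℕ.∸ m)) ⟩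
    - ((n ℕ.∸ m) • 1#)                          ≈⟨ +-identityˡ _ ⟨
    0# + - ((n ℕ.∸ m) • 1#)                     ≈⟨ +-congʳ (-‿inverseʳ _) ⟨
    m • 1# + - (m • 1#) + - ((n ℕ.∸ m) • 1#)    ≈⟨ +-assoc _ _ _ ⟩
    m • 1# + (- (m • 1#) + - ((n ℕ.∸ m) • 1#))  ≈⟨ +-congˡ (-‿+-comm _ _) ⟩
    m • 1# + - (m • 1# + (n ℕ.∸ m) • 1#)        ≈⟨ +-congˡ (-‿cong (×-homo-+ 1# m (n ℕ.∸ m))) ⟨
    m • 1# + - ((m ℕ.+ (n ℕ.∸ m)) • 1#)         ≡⟨ ≡.cong (λ k → m • 1# + - (k • 1#)) (ℕₚ.m+[n∸m]≡n m≤n) ⟩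
    m • 1# + - (n • 1#)                         ∎

  +-homo : ∀ i j → ⟦ i ℤ.+ j ⟧ℤ ≈ ⟦ i ⟧ℤ + ⟦ j ⟧ℤ
  +-homo (+ m)    (+ n)    = ×-homo-+ 1# m n
  +-homo (+ m)    -[1+ n ] = ⊖-homo m (suc n)
  +-homo -[1+ m ] (+ n)    = trans (⊖-homo n (suc m)) (+-comm _ _)
  +-homo -[1+ m ] -[1+ n ] = begin
    - (suc (suc (m ℕ.+ n)) • 1#)      ≡⟨ ≡.cong (λ k → - (suc k • 1#)) (ℕₚ.+-suc m n) ⟨
    - ((suc m ℕ.+ suc n) • 1#)        ≈⟨ -‿cong (×-homo-+ 1# (suc m) (suc n)) ⟩
    - (suc m • 1# + suc n • 1#)       ≈⟨ -‿+-comm _ _ ⟨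
    - (suc m • 1#) + - (suc n • 1#)   ∎

  +*-homo : ∀ m j → ⟦ + m ℤ.* j ⟧ℤ ≈ m • 1# * ⟦ j ⟧ℤ
  +*-homo m (+ n) = trans (reflexive (≡.cong ⟦_⟧ℤ (≡.sym (ℤₚ.pos-* m n)))) (×1-homo-* m n)
  +*-homo m -[1+ n ] = begin
    ⟦ + m ℤ.* -[1+ n ] ⟧ℤ         ≡⟨ ≡.cong ⟦_⟧ℤ (ℤₚ.neg-distribʳ-* (+ m) (+ suc n)) ⟨
    ⟦ ℤ.- (+ m ℤ.* + suc n) ⟧ℤ    ≈⟨ -‿homo (+ m ℤ.* + suc n) ⟩
    - ⟦ + m ℤ.* + suc n ⟧ℤ        ≈⟨ -‿cong (+*-homo m (+ suc n)) ⟩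
    - (m • 1# * suc n • 1#)       ≈⟨ -‿distribʳ-* _ _ ⟩
    m • 1# * - (suc n • 1#)       ∎

  *-homo : ∀ i j → ⟦ i ℤ.* j ⟧ℤ ≈ ⟦ i ⟧ℤ * ⟦ j ⟧ℤ
  *-homo (+ m)    j = +*-homo m j
  *-homo -[1+ m ] j = begin
    ⟦ -[1+ m ] ℤ.* j ⟧ℤ         ≡⟨ ≡.cong ⟦_⟧ℤ (ℤₚ.neg-distribˡ-* (+ suc m) j) ⟨
    ⟦ ℤ.- (+ suc m ℤ.* j) ⟧ℤ    ≈⟨ -‿homo (+ suc m ℤ.* j) ⟩
    - ⟦ + suc m ℤ.* j ⟧ℤ        ≈⟨ -‿cong (+*-homo (suc m) j) ⟩
    - (suc m • 1# * ⟦ j ⟧ℤ)     ≈⟨ -‿distribˡ-* _ _ ⟩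
    - (suc m • 1#) * ⟦ j ⟧ℤ     ∎

  ℤ-homomorphism : ℤ.+-*-rawRing -Raw-AlmostCommutative⟶ fromCommutativeRing (Reals.commutativeRing ℝ)
  ℤ-homomorphism = record
    { ⟦_⟧    = ⟦_⟧ℤ
    ; +-homo = +-homo
    ; *-homo = *-homo
    ; -‿homo = -‿homo
    ; 0-homo = refl
    ; 1-homo = refl
    }

  _ℤ≟_ : ∀ i j → Maybe (⟦ i ⟧ℤ ≈ ⟦ j ⟧ℤ)
  i ℤ≟ j with i ℤₚ.≟ j
  ... | yes i≡j = just (reflexive (≡.cong ⟦_⟧ℤ i≡j))
  ... | no  _   = nothing

  open Algebra.Solver.Ring ℤ.+-*-rawRing (fromCommutativeRing (Reals.commutativeRing ℝ)) ℤ-homomorphism _ℤ≟_ public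
    using (Polynomial; solve; _:=_; _:+_; _:*_; _:-_; :-_; con)

module Field (ℝ : Reals) where
  open Reals ℝ public
  open CommutativeRing commutativeRing public
    using (refl; sym; trans; reflexive; setoid; ring
          ; +-cong; +-congˡ; +-congʳ; *-cong; *-congˡ; *-congʳ; -‿cong
          ; +-assoc; +-comm; +-identityˡ; +-identityʳ; -‿inverseʳ; -‿inverseˡ
          ; *-assoc; *-comm; *-identityˡ; *-identityʳ; zeroˡ; zeroʳ; distribʳ)
  open IsDecTotalOrder isDecTotalOrder public
    using () renaming (_≟_ to _≈?_; total to ≤-total; trans to ≤-trans; antisym to ≤-antisym; reflexive to ≤-reflexive; refl to ≤-refl)
  open Algebra.Properties.Ring ring public using (-0#≈0#; x∙y⁻¹≈ε⇒x≈y; x≈y⇒x∙y⁻¹≈ε)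
  open IntegerSolver ℝ public using (Polynomial; solve; _:=_; _:+_; _:*_; _:-_; :-_; con)
  open Relation.Binary.Reasoning.Setoid setoid public

  ≤-respʳ : ∀ {x y z} → y ≈ z → x ≤ y → x ≤ z
  ≤-respʳ y≈z x≤y = ≤-trans x≤y (≤-reflexive y≈z)

  ≤-respˡ : ∀ {x y z} → y ≈ z → y ≤ x → z ≤ x
  ≤-respˡ y≈z y≤x = ≤-trans (≤-reflexive (sym y≈z)) y≤x

  -- Inequalities are handled through nonnegativity of differences, which the
  -- ring solver can rearrange.
  ≤⇒0≤ : ∀ {x y} → x ≤ y → 0# ≤ y - x
  ≤⇒0≤ {x} x≤y = ≤-respˡ (-‿inverseʳ x) (+-monoˡ-≤ (- x) x≤y)

  0≤⇒≤ : ∀ {x y} → 0# ≤ y - x → x ≤ y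
  0≤⇒≤ {x} {y} 0≤ =
    ≤-respʳ (solve 2 (λ x y → y :- x :+ x := y) refl x y) (≤-respˡ (+-identityˡ x) (+-monoˡ-≤ x 0≤))

  0≤+ : ∀ {x y} → 0# ≤ x → 0# ≤ y → 0# ≤ x + y
  0≤+ {x} {y} 0≤x 0≤y = ≤-trans 0≤y (≤-respˡ (+-identityˡ y) (+-monoˡ-≤ y 0≤x))

  0≤1 : 0# ≤ 1#
  0≤1 with ≤-total 0# 1#
  ... | inj₁ 0≤1 = 0≤1
  ... | inj₂ 1≤0 = ≤-respʳ (solve 0 (:- con (+ 1) :* :- con (+ 1) := con (+ 1)) refl) (*-nonNegative 0≤-1 0≤-1)
    where
    0≤-1 : 0# ≤ - 1#
    0≤-1 = ≤-respʳ (+-identityˡ _) (≤⇒0≤ 1≤0)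

  0<1 : 0# < 1#
  0<1 = 0≤1 , 0≉1

  1≉0 : 1# ≉ 0#
  1≉0 1≈0 = 0≉1 (sym 1≈0)

  0<⇒≉0 : ∀ {x} → 0# < x → x ≉ 0#
  0<⇒≉0 (_ , 0≉x) x≈0 = 0≉x (sym x≈0)

  *-zero-cancelˡ : ∀ {x y} → x ≉ 0# → x * y ≈ 0# → y ≈ 0#
  *-zero-cancelˡ {x} {y} x≉0 xy≈0 = begin
    y                ≈⟨ *-identityˡ y ⟨
    1# * y           ≈⟨ *-congʳ (⁻¹-inverseʳ x x≉0) ⟨
    x * x ⁻¹ * y     ≈⟨ solve 3 (λ x i y → x :* i :* y := i :* (x :* y)) refl x (x ⁻¹) y ⟩
    x ⁻¹ * (x * y)   ≈⟨ *-congˡ xy≈0 ⟩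
    x ⁻¹ * 0#        ≈⟨ zeroʳ _ ⟩
    0#               ∎

  *-cancelˡ : ∀ {x y z} → x ≉ 0# → x * y ≈ x * z → y ≈ z
  *-cancelˡ {x} {y} {z} x≉0 xy≈xz = x∙y⁻¹≈ε⇒x≈y y z (*-zero-cancelˡ x≉0 (begin
    x * (y - z)      ≈⟨ solve 3 (λ x y z → x :* (y :- z) := x :* y :- x :* z) refl x y z ⟩
    x * y - x * z    ≈⟨ x≈y⇒x∙y⁻¹≈ε xy≈xz ⟩
    0#               ∎))

  *-≉0 : ∀ {x y} → x ≉ 0# → y ≉ 0# → x * y ≉ 0#
  *-≉0 x≉0 y≉0 xy≈0 = y≉0 (*-zero-cancelˡ x≉0 xy≈0)

  *-÷-cancel : ∀ {x} y → x ≉ 0# → x * (y ÷ x) ≈ y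
  *-÷-cancel {x} y x≉0 = begin
    x * (y * x ⁻¹)   ≈⟨ solve 3 (λ x y i → x :* (y :* i) := y :* (x :* i)) refl x y (x ⁻¹) ⟩
    y * (x * x ⁻¹)   ≈⟨ *-congˡ (⁻¹-inverseʳ x x≉0) ⟩
    y * 1#           ≈⟨ *-identityʳ y ⟩
    y                ∎

  0<*0< : ∀ {x y} → 0# < x → 0# < y → 0# < x * y
  0<*0< 0<x 0<y = *-nonNegative (proj₁ 0<x) (proj₁ 0<y) , λ 0≈xy → *-≉0 (0<⇒≉0 0<x) (0<⇒≉0 0<y) (sym 0≈xy)

  0<-≤-trans : ∀ {x y} → 0# < x → x ≤ y → 0# < y
  0<-≤-trans (0≤x , 0≉x) x≤y = ≤-trans 0≤x x≤y , λ 0≈y → 0≉x (≤-antisym 0≤x (≤-respʳ (sym 0≈y) x≤y))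

  0<+0≤ : ∀ {x y} → 0# < x → 0# ≤ y → 0# < x + y
  0<+0≤ {x} {y} 0<x 0≤y =
    0<-≤-trans 0<x (0≤⇒≤ (≤-respʳ (solve 2 (λ x y → y := x :+ y :- x) refl x y) 0≤y))

  0<-resp : ∀ {x y} → x ≈ y → 0# < x → 0# < y
  0<-resp x≈y 0<x = 0<-≤-trans 0<x (≤-reflexive x≈y)

  0≤fromℕ : ∀ n → 0# ≤ fromℕ n
  0≤fromℕ zero    = ≤-refl
  0≤fromℕ (suc n) = 0≤+ 0≤1 (0≤fromℕ n)

  0<fromℕ : ∀ {n} → 0 ℕ.< n → 0# < fromℕ n
  0<fromℕ {suc n} _ = 0<+0≤ 0<1 (0≤fromℕ n)

  2≈1+1 : fromℕ 2 ≈ 1# + 1#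
  2≈1+1 = +-congˡ (+-identityʳ 1#)

-- Polynomials over the reals

module Polynomials (ℝ : Reals) where
  open Field ℝ public
  open RationalFunctions ℝ public

  ⟦+ₚ⟧ : ∀ p q t → ⟦ p +ₚ q ⟧ t ≈ ⟦ p ⟧ t + ⟦ q ⟧ t
  ⟦+ₚ⟧ []      q       t = sym (+-identityˡ _)
  ⟦+ₚ⟧ (a ∷ p) []      t = sym (+-identityʳ _)
  ⟦+ₚ⟧ (a ∷ p) (b ∷ q) t = begin
    a + b + t * ⟦ p +ₚ q ⟧ t               ≈⟨ +-congˡ (*-congˡ (⟦+ₚ⟧ p q t)) ⟩
    a + b + t * (⟦ p ⟧ t + ⟦ q ⟧ t)        ≈⟨ solve 5 (λ a b t p q → a :+ b :+ t :* (p :+ q) := a :+ t :* p :+ (b :+ t :* q)) refl a b t (⟦ p ⟧ t) (⟦ q ⟧ t) ⟩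
    a + t * ⟦ p ⟧ t + (b + t * ⟦ q ⟧ t)    ∎

  ⟦map*⟧ : ∀ a q t → ⟦ map (a *_) q ⟧ t ≈ a * ⟦ q ⟧ t
  ⟦map*⟧ a []      t = sym (zeroʳ a)
  ⟦map*⟧ a (b ∷ q) t = begin
    a * b + t * ⟦ map (a *_) q ⟧ t    ≈⟨ +-congˡ (*-congˡ (⟦map*⟧ a q t)) ⟩
    a * b + t * (a * ⟦ q ⟧ t)         ≈⟨ solve 4 (λ a b t q → a :* b :+ t :* (a :* q) := a :* (b :+ t :* q)) refl a b t (⟦ q ⟧ t) ⟩
    a * (b + t * ⟦ q ⟧ t)             ∎

  ⟦*ₚ⟧ : ∀ p q t → ⟦ p *ₚ q ⟧ t ≈ ⟦ p ⟧ t * ⟦ q ⟧ t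
  ⟦*ₚ⟧ []      q t = sym (zeroˡ _)
  ⟦*ₚ⟧ (a ∷ p) q t = begin
    ⟦ map (a *_) q +ₚ (0# ∷ p *ₚ q) ⟧ t              ≈⟨ ⟦+ₚ⟧ (map (a *_) q) (0# ∷ p *ₚ q) t ⟩
    ⟦ map (a *_) q ⟧ t + (0# + t * ⟦ p *ₚ q ⟧ t)     ≈⟨ +-cong (⟦map*⟧ a q t) (+-congˡ (*-congˡ (⟦*ₚ⟧ p q t))) ⟩
    a * ⟦ q ⟧ t + (0# + t * (⟦ p ⟧ t * ⟦ q ⟧ t))     ≈⟨ solve 4 (λ a t p q → a :* q :+ (con (+ 0) :+ t :* (p :* q)) := (a :+ t :* p) :* q) refl a t (⟦ p ⟧ t) (⟦ q ⟧ t) ⟩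
    (a + t * ⟦ p ⟧ t) * ⟦ q ⟧ t                      ∎

  ⟦-ₚ⟧ : ∀ p t → ⟦ -ₚ p ⟧ t ≈ - ⟦ p ⟧ t
  ⟦-ₚ⟧ []      t = sym -0#≈0#
  ⟦-ₚ⟧ (a ∷ p) t = begin
    - a + t * ⟦ -ₚ p ⟧ t      ≈⟨ +-congˡ (*-congˡ (⟦-ₚ⟧ p t)) ⟩
    - a + t * - ⟦ p ⟧ t       ≈⟨ solve 3 (λ a t p → :- a :+ t :* :- p := :- (a :+ t :* p)) refl a t (⟦ p ⟧ t) ⟩
    - (a + t * ⟦ p ⟧ t)       ∎

  _-ₚ′_ : Poly → Poly → Poly
  p -ₚ′ q = p +ₚ (-ₚ q)

  ⟦-ₚ′⟧ : ∀ p q t → ⟦ p -ₚ′ q ⟧ t ≈ ⟦ p ⟧ t - ⟦ q ⟧ t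
  ⟦-ₚ′⟧ p q t = trans (⟦+ₚ⟧ p (-ₚ q) t) (+-congˡ (⟦-ₚ⟧ q t))

  ⟦const⟧ : ∀ a t → ⟦ [ a ] ⟧ t ≈ a
  ⟦const⟧ a t = trans (+-congˡ (zeroʳ t)) (+-identityʳ a)

  ⟦var⟧ : ∀ t → ⟦ num var ⟧ t ≈ t
  ⟦var⟧ t = solve 1 (λ t → con (+ 0) :+ t :* (con (+ 1) :+ t :* con (+ 0)) := t) refl t

  sumₚ : ∀ {n} → Vector Poly n → Poly
  sumₚ = Vector.foldr _+ₚ_ []

  ⟦sumₚ⟧ : ∀ {n} (f : Vector Poly n) t → ⟦ sumₚ f ⟧ t ≈ ∑[ i < n ] ⟦ f i ⟧ t
  ⟦sumₚ⟧ {zero}  f t = refl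
  ⟦sumₚ⟧ {suc n} f t = trans (⟦+ₚ⟧ (f zero) (sumₚ (λ i → f (suc i))) t) (+-congˡ (⟦sumₚ⟧ (λ i → f (suc i)) t))

  EventuallyPositive : Poly → Set
  EventuallyPositive p = ∃[ N ] ∃[ ε ] 0# < ε × (∀ t → N ≤ t → ε ≤ ⟦ p ⟧ t)

  Null : Poly → Set
  Null p = ∀ t → ⟦ p ⟧ t ≈ 0#

  max : ∀ x y → ∃[ m ] x ≤ m × y ≤ m
  max x y with ≤-total x y
  ... | inj₁ x≤y = y , x≤y , ≤-refl
  ... | inj₂ y≤x = x , ≤-refl , y≤x

  -- Beyond N, 0 and (ε - a) / ε one has a + t p(t) ≥ a + t ε ≥ ε.
  eventuallyPositive-∷ : ∀ a {p} → EventuallyPositive p → EventuallyPositive (a ∷ p)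
  eventuallyPositive-∷ a {p} (N , ε , 0<ε , bound) with max N ((ε - a) ÷ ε)
  ... | m , N≤m , r≤m = max≥0 (max m 0#)
    where
    max≥0 : ∃[ m′ ] m ≤ m′ × 0# ≤ m′ → EventuallyPositive (a ∷ p)
    max≥0 (m′ , m≤m′ , 0≤m′) = m′ , ε , 0<ε , λ t m′≤t → 0≤⇒≤ (≤-respʳ
      (begin
        t * (⟦ p ⟧ t - ε) + ε * (t - (ε - a) ÷ ε)
          ≈⟨ solve 4 (λ t p e r → t :* (p :- e) :+ e :* (t :- r) := t :* p :- e :* r) refl t (⟦ p ⟧ t) ε ((ε - a) ÷ ε) ⟩
        t * ⟦ p ⟧ t - ε * ((ε - a) ÷ ε)
          ≈⟨ +-congˡ (-‿cong (*-÷-cancel (ε - a) (0<⇒≉0 0<ε))) ⟩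
        t * ⟦ p ⟧ t - (ε - a)
          ≈⟨ solve 4 (λ t p e a → t :* p :- (e :- a) := a :+ t :* p :- e) refl t (⟦ p ⟧ t) ε a ⟩
        a + t * ⟦ p ⟧ t - ε ∎)
      (0≤+ (*-nonNegative (≤-trans 0≤m′ m′≤t) (≤⇒0≤ (bound t (≤-trans N≤m (≤-trans m≤m′ m′≤t)))))
           (*-nonNegative (proj₁ 0<ε) (≤⇒0≤ (≤-trans r≤m (≤-trans m≤m′ m′≤t))))))

  eventual-sign : ∀ p → Null p ⊎ EventuallyPositive p ⊎ EventuallyPositive (-ₚ p)
  eventual-sign [] = inj₁ λ _ → refl
  eventual-sign (a ∷ p) with eventual-sign p
  ... | inj₂ (inj₁ pos) = inj₂ (inj₁ (eventuallyPositive-∷ a {p} pos))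
  ... | inj₂ (inj₂ neg) = inj₂ (inj₂ (eventuallyPositive-∷ (- a) { -ₚ p } neg))
  ... | inj₁ null = constant (a ≈? 0#) (≤-total 0# a)
    where
    ⟦a∷p⟧ : ∀ t → ⟦ a ∷ p ⟧ t ≈ a
    ⟦a∷p⟧ t = trans (+-congˡ (trans (*-congˡ (null t)) (zeroʳ t))) (+-identityʳ a)

    ⟦-a∷p⟧ : ∀ t → ⟦ -ₚ (a ∷ p) ⟧ t ≈ - a
    ⟦-a∷p⟧ t = trans (⟦-ₚ⟧ (a ∷ p) t) (-‿cong (⟦a∷p⟧ t))

    constant : Dec (a ≈ 0#) → 0# ≤ a ⊎ a ≤ 0# → Null (a ∷ p) ⊎ EventuallyPositive (a ∷ p) ⊎ EventuallyPositive (-ₚ (a ∷ p))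
    constant (yes a≈0) _ = inj₁ λ t → trans (⟦a∷p⟧ t) a≈0
    constant (no a≉0) (inj₁ 0≤a) =
      inj₂ (inj₁ (0# , a , (0≤a , λ 0≈a → a≉0 (sym 0≈a)) , λ t _ → ≤-reflexive (sym (⟦a∷p⟧ t))))
    constant (no a≉0) (inj₂ a≤0) =
      inj₂ (inj₂ (0# , - a , (≤-respʳ (+-identityˡ _) (≤⇒0≤ a≤0) , λ 0≈-a → a≉0 (begin
          a          ≈⟨ solve 1 (λ a → a := :- (:- a)) refl a ⟩
          - (- a)    ≈⟨ -‿cong 0≈-a ⟨
          - 0#       ≈⟨ -0#≈0# ⟩
          0#         ∎)) ,
        λ t _ → ≤-reflexive (sym (⟦-a∷p⟧ t))))

  null⊎eventually≉0 : ∀ p → Null p ⊎ (∃[ N ] ∀ t → N ≤ t → ⟦ p ⟧ t ≉ 0#)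
  null⊎eventually≉0 p with eventual-sign p
  ... | inj₁ null = inj₁ null
  ... | inj₂ (inj₁ (N , ε , 0<ε , bound)) = inj₂ (N , λ t N≤t → 0<⇒≉0 (0<-≤-trans 0<ε (bound t N≤t)))
  ... | inj₂ (inj₂ (N , ε , 0<ε , bound)) = inj₂ (N , λ t N≤t p≈0 →
    0<⇒≉0 (0<-≤-trans 0<ε (bound t N≤t)) (trans (⟦-ₚ⟧ p t) (trans (-‿cong p≈0) -0#≈0#)))

  null-cancelˡ : ∀ p q {t₀} → ⟦ p ⟧ t₀ ≉ 0# → (∀ t → ⟦ p ⟧ t * ⟦ q ⟧ t ≈ 0#) → Null q
  null-cancelˡ p q {t₀} p≉0 pq≈0 with null⊎eventually≉0 p | null⊎eventually≉0 q
  ... | inj₁ null      | _            = contradiction (null t₀) p≉0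
  ... | inj₂ _         | inj₁ null    = null
  ... | inj₂ (M , p≉)  | inj₂ (N , q≉) with max M N
  ...   | t , M≤t , N≤t = contradiction (pq≈0 t) (*-≉0 (p≉ t M≤t) (q≉ t N≤t))

  -- The common factor b is cancelled as a polynomial, so its zeros do not matter.
  cross-multiply : ∀ a b p q r s {t₀} → ⟦ b ⟧ t₀ ≉ 0# →
                   (∀ t → ⟦ p ⟧ t * ⟦ b ⟧ t ≈ ⟦ a ⟧ t * ⟦ q ⟧ t) →
                   (∀ t → ⟦ r ⟧ t * ⟦ b ⟧ t ≈ ⟦ a ⟧ t * ⟦ s ⟧ t) →
                   ∀ t → ⟦ p ⟧ t * ⟦ s ⟧ t ≈ ⟦ r ⟧ t * ⟦ q ⟧ t
  cross-multiply a b p q r s b≉0 pb≈aq rb≈as t = x∙y⁻¹≈ε⇒x≈y _ _ (trans (sym (eval t)) (null-cancelˡ b D b≉0 bD≈0 t))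
    where
    D : Poly
    D = (p *ₚ s) -ₚ′ (r *ₚ q)

    eval : ∀ t → ⟦ D ⟧ t ≈ ⟦ p ⟧ t * ⟦ s ⟧ t - ⟦ r ⟧ t * ⟦ q ⟧ t
    eval t = trans (⟦-ₚ′⟧ (p *ₚ s) (r *ₚ q) t) (+-cong (⟦*ₚ⟧ p s t) (-‿cong (⟦*ₚ⟧ r q t)))

    bD≈0 : ∀ t → ⟦ b ⟧ t * ⟦ D ⟧ t ≈ 0#
    bD≈0 t = begin
      ⟦ b ⟧ t * ⟦ D ⟧ t                                     ≈⟨ *-congˡ (eval t) ⟩
      ⟦ b ⟧ t * (⟦ p ⟧ t * ⟦ s ⟧ t - ⟦ r ⟧ t * ⟦ q ⟧ t)     ≈⟨ solve 5 (λ b p s r q → b :* (p :* s :- r :* q) := p :* b :* s :- r :* b :* q) refl (⟦ b ⟧ t) (⟦ p ⟧ t) (⟦ s ⟧ t) (⟦ r ⟧ t) (⟦ q ⟧ t) ⟩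
      ⟦ p ⟧ t * ⟦ b ⟧ t * ⟦ s ⟧ t - ⟦ r ⟧ t * ⟦ b ⟧ t * ⟦ q ⟧ t    ≈⟨ +-cong (*-congʳ (pb≈aq t)) (-‿cong (*-congʳ (rb≈as t))) ⟩
      ⟦ a ⟧ t * ⟦ q ⟧ t * ⟦ s ⟧ t - ⟦ a ⟧ t * ⟦ s ⟧ t * ⟦ q ⟧ t    ≈⟨ solve 3 (λ a q s → a :* q :* s :- a :* s :* q := con (+ 0)) refl (⟦ a ⟧ t) (⟦ q ⟧ t) (⟦ s ⟧ t) ⟩
      0#                                                    ∎

-- Linear algebra

module Sums (ℝ : Reals) where
  open Polynomials ℝ public
  open Algebra.Properties.Semiring.Sum semiring public
    using (sum-cong-≋; ∑-distrib-+; *-distribˡ-sum; ∑-comm; sum-replicate-zero)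

  sum-zero : ∀ {n} {f : Vector Carrier n} → (∀ i → f i ≈ 0#) → sum f ≈ 0#
  sum-zero {n} f≈0 = trans (sum-cong-≋ f≈0) (sum-replicate-zero n)

  ∑-distrib-sub : ∀ {n} (f g : Vector Carrier n) → ∑[ i < n ] (f i - g i) ≈ sum f - sum g
  ∑-distrib-sub {n} f g = begin
    ∑[ i < n ] (f i - g i)          ≈⟨ ∑-distrib-+ f (λ i → - g i) ⟩
    sum f + ∑[ i < n ] (- g i)      ≈⟨ +-congˡ (sum-cong-≋ (λ i → solve 1 (λ x → :- x := :- con (+ 1) :* x) refl (g i))) ⟩
    sum f + ∑[ i < n ] (- 1# * g i) ≈⟨ +-congˡ (*-distribˡ-sum (- 1#) g) ⟨
    sum f + - 1# * sum g            ≈⟨ solve 2 (λ x y → x :+ :- con (+ 1) :* y := x :- y) refl (sum f) (sum g) ⟩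
    sum f - sum g                   ∎

  ∑-indicator : ∀ {n} (k : Fin n) (f : Vector Carrier n) → ∑[ i < n ] (if does (k ≟ i) then f i else 0#) ≈ f k
  ∑-indicator zero    f = trans (+-congˡ (sum-zero {f = λ i → if does (Fin.zero ≟ suc i) then f (suc i) else 0#} (λ _ → refl))) (+-identityʳ _)
  ∑-indicator {suc n} (suc k) f = trans (+-identityˡ _) (∑-indicator k (λ i → f (suc i)))

module Elimination (ℝ : Reals) (μ : Reals.Carrier ℝ) where
  open Sums ℝ

  PolyMatrix : ℕ → Set
  PolyMatrix n = Fin n → Fin n → Poly

  SingularAt : ∀ {n} → PolyMatrix n → Set
  SingularAt {n} M = Σ[ z ∈ Vector Carrier n ] (∃[ i ] z i ≉ 0#) × (∀ i → ∑[ k < n ] (⟦ M i k ⟧ μ * z k) ≈ 0#)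

  -- Solvability over the ring of rational functions regular at μ, with
  -- denominators cleared.
  SolvableNear : ∀ {n} → PolyMatrix n → Set
  SolvableNear {n} M = (b : Vector Poly n) → Σ[ x ∈ Vector Poly n ] Σ[ δ ∈ Poly ] ⟦ δ ⟧ μ ≉ 0# ×
    (∀ t i → ∑[ k < n ] (⟦ M i k ⟧ t * ⟦ x k ⟧ t) ≈ ⟦ δ ⟧ t * ⟦ b i ⟧ t)

  module Pivot {n} (M : PolyMatrix (suc n)) (r : Fin (suc n)) (pivot : ⟦ M r zero ⟧ μ ≉ 0#) where

    a : Poly
    a = M r zero

    reduced : PolyMatrix n
    reduced i k = (a *ₚ M (punchIn r i) (suc k)) -ₚ′ (M (punchIn r i) zero *ₚ M r (suc k))

    rows : (Q : Fin (suc n) → Set) → Q r → (∀ i → Q (punchIn r i)) → ∀ i → Q i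
    rows Q Qr Qrest i with r ≟ i
    ... | yes ≡.refl = Qr
    ... | no  r≢i    = ≡.subst Q (punchIn-punchOut r≢i) (Qrest (punchOut r≢i))

    reduced-row : ∀ i (w : Vector Carrier n) t →
      ∑[ k < n ] (⟦ reduced i k ⟧ t * w k) ≈
      ⟦ a ⟧ t * ∑[ k < n ] (⟦ M (punchIn r i) (suc k) ⟧ t * w k)
        - ⟦ M (punchIn r i) zero ⟧ t * ∑[ k < n ] (⟦ M r (suc k) ⟧ t * w k)
    reduced-row i w t = begin
      ∑[ k < n ] (⟦ reduced i k ⟧ t * w k)
        ≈⟨ sum-cong-≋ (λ k → trans (*-congʳ (trans (⟦-ₚ′⟧ (a *ₚ R′ k) (m₀ *ₚ R k) t) (+-cong (⟦*ₚ⟧ a (R′ k) t) (-‿cong (⟦*ₚ⟧ m₀ (R k) t)))))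
             (solve 5 (λ a x m y w → (a :* x :- m :* y) :* w := a :* (x :* w) :- m :* (y :* w)) refl (⟦ a ⟧ t) (⟦ R′ k ⟧ t) (⟦ m₀ ⟧ t) (⟦ R k ⟧ t) (w k))) ⟩
      ∑[ k < n ] (⟦ a ⟧ t * (⟦ R′ k ⟧ t * w k) - ⟦ m₀ ⟧ t * (⟦ R k ⟧ t * w k))
        ≈⟨ ∑-distrib-sub (λ k → ⟦ a ⟧ t * (⟦ R′ k ⟧ t * w k)) (λ k → ⟦ m₀ ⟧ t * (⟦ R k ⟧ t * w k)) ⟩
      ∑[ k < n ] (⟦ a ⟧ t * (⟦ R′ k ⟧ t * w k)) - ∑[ k < n ] (⟦ m₀ ⟧ t * (⟦ R k ⟧ t * w k))
        ≈⟨ +-cong (*-distribˡ-sum (⟦ a ⟧ t) (λ k → ⟦ R′ k ⟧ t * w k)) (-‿cong (*-distribˡ-sum (⟦ m₀ ⟧ t) (λ k → ⟦ R k ⟧ t * w k))) ⟨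
      ⟦ a ⟧ t * ∑[ k < n ] (⟦ R′ k ⟧ t * w k) - ⟦ m₀ ⟧ t * ∑[ k < n ] (⟦ R k ⟧ t * w k) ∎
      where
      m₀ : Poly
      m₀ = M (punchIn r i) zero
      R′ R : Fin n → Poly
      R′ k = M (punchIn r i) (suc k)
      R k = M r (suc k)

    singular : SingularAt reduced → SingularAt M
    singular (w , (i₀ , w≉0) , reduced≈0) = z , (suc i₀ , w≉0) , rows _ row-r row
      where
      s : Carrier
      s = ∑[ k < n ] (⟦ M r (suc k) ⟧ μ * w k)
      z : Vector Carrier (suc n)
      z zero    = - s ÷ ⟦ a ⟧ μ
      z (suc k) = w k

      az₀≈-s : ⟦ a ⟧ μ * z zero ≈ - s
      az₀≈-s = *-÷-cancel (- s) pivot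

      row-r : ⟦ a ⟧ μ * z zero + s ≈ 0#
      row-r = trans (+-congʳ az₀≈-s) (-‿inverseˡ s)

      row : ∀ i → ⟦ M (punchIn r i) zero ⟧ μ * z zero + ∑[ k < n ] (⟦ M (punchIn r i) (suc k) ⟧ μ * w k) ≈ 0#
      row i = *-zero-cancelˡ pivot (begin
        ⟦ a ⟧ μ * (m₀ * z zero + s′)           ≈⟨ solve 4 (λ a m z s′ → a :* (m :* z :+ s′) := m :* (a :* z) :+ a :* s′) refl (⟦ a ⟧ μ) m₀ (z zero) s′ ⟩
        m₀ * (⟦ a ⟧ μ * z zero) + ⟦ a ⟧ μ * s′ ≈⟨ +-congʳ (*-congˡ az₀≈-s) ⟩
        m₀ * - s + ⟦ a ⟧ μ * s′                ≈⟨ solve 4 (λ m s a s′ → m :* :- s :+ a :* s′ := a :* s′ :- m :* s) refl m₀ s (⟦ a ⟧ μ) s′ ⟩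
        ⟦ a ⟧ μ * s′ - m₀ * s                  ≈⟨ reduced-row i w μ ⟨
        ∑[ k < n ] (⟦ reduced i k ⟧ μ * w k)   ≈⟨ reduced≈0 i ⟩
        0#                                     ∎)
        where
        m₀ s′ : Carrier
        m₀ = ⟦ M (punchIn r i) zero ⟧ μ
        s′ = ∑[ k < n ] (⟦ M (punchIn r i) (suc k) ⟧ μ * w k)

    solvable : SolvableNear reduced → SolvableNear M
    solvable solve′ b with solve′ (λ i → (a *ₚ b (punchIn r i)) -ₚ′ (M (punchIn r i) zero *ₚ b r))
    ... | y , ε , ε≉0 , reduced≈ =
      x , a *ₚ ε , (λ aε≈0 → *-≉0 pivot ε≉0 (trans (sym (⟦*ₚ⟧ a ε μ)) aε≈0)) , λ t → rows _ (row-r t) (row t)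
      where
      sₚ : Poly
      sₚ = sumₚ λ k → M r (suc k) *ₚ y k
      x : Vector Poly (suc n)
      x zero    = (ε *ₚ b r) -ₚ′ sₚ
      x (suc k) = a *ₚ y k

      s : Carrier → Carrier
      s t = ∑[ k < n ] (⟦ M r (suc k) ⟧ t * ⟦ y k ⟧ t)

      ⟦x₀⟧ : ∀ t → ⟦ x zero ⟧ t ≈ ⟦ ε ⟧ t * ⟦ b r ⟧ t - s t
      ⟦x₀⟧ t = trans (⟦-ₚ′⟧ (ε *ₚ b r) sₚ t) (+-cong (⟦*ₚ⟧ ε (b r) t) (-‿cong
        (trans (⟦sumₚ⟧ (λ k → M r (suc k) *ₚ y k) t) (sum-cong-≋ (λ k → ⟦*ₚ⟧ (M r (suc k)) (y k) t)))))

      tail : ∀ i t → ∑[ k < n ] (⟦ M i (suc k) ⟧ t * ⟦ x (suc k) ⟧ t) ≈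
                     ⟦ a ⟧ t * ∑[ k < n ] (⟦ M i (suc k) ⟧ t * ⟦ y k ⟧ t)
      tail i t = begin
        ∑[ k < n ] (⟦ M i (suc k) ⟧ t * ⟦ a *ₚ y k ⟧ t)           ≈⟨ sum-cong-≋ (λ k → trans (*-congˡ (⟦*ₚ⟧ a (y k) t))
          (solve 3 (λ m a y → m :* (a :* y) := a :* (m :* y)) refl (⟦ M i (suc k) ⟧ t) (⟦ a ⟧ t) (⟦ y k ⟧ t))) ⟩
        ∑[ k < n ] (⟦ a ⟧ t * (⟦ M i (suc k) ⟧ t * ⟦ y k ⟧ t))    ≈⟨ *-distribˡ-sum (⟦ a ⟧ t) (λ k → ⟦ M i (suc k) ⟧ t * ⟦ y k ⟧ t) ⟨
        ⟦ a ⟧ t * ∑[ k < n ] (⟦ M i (suc k) ⟧ t * ⟦ y k ⟧ t)      ∎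

      row-r : ∀ t → ⟦ a ⟧ t * ⟦ x zero ⟧ t + ∑[ k < n ] (⟦ M r (suc k) ⟧ t * ⟦ x (suc k) ⟧ t) ≈ ⟦ a *ₚ ε ⟧ t * ⟦ b r ⟧ t
      row-r t = begin
        ⟦ a ⟧ t * ⟦ x zero ⟧ t + ∑[ k < n ] (⟦ M r (suc k) ⟧ t * ⟦ x (suc k) ⟧ t)
          ≈⟨ +-cong (*-congˡ (⟦x₀⟧ t)) (tail r t) ⟩
        ⟦ a ⟧ t * (⟦ ε ⟧ t * ⟦ b r ⟧ t - s t) + ⟦ a ⟧ t * s t
          ≈⟨ solve 4 (λ a e b s → a :* (e :* b :- s) :+ a :* s := a :* e :* b) refl (⟦ a ⟧ t) (⟦ ε ⟧ t) (⟦ b r ⟧ t) (s t) ⟩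
        ⟦ a ⟧ t * ⟦ ε ⟧ t * ⟦ b r ⟧ t    ≈⟨ *-congʳ (⟦*ₚ⟧ a ε t) ⟨
        ⟦ a *ₚ ε ⟧ t * ⟦ b r ⟧ t         ∎

      row : ∀ t i → ⟦ M (punchIn r i) zero ⟧ t * ⟦ x zero ⟧ t + ∑[ k < n ] (⟦ M (punchIn r i) (suc k) ⟧ t * ⟦ x (suc k) ⟧ t)
                    ≈ ⟦ a *ₚ ε ⟧ t * ⟦ b (punchIn r i) ⟧ t
      row t i = begin
        m₀ * ⟦ x zero ⟧ t + ∑[ k < n ] (⟦ M i′ (suc k) ⟧ t * ⟦ x (suc k) ⟧ t)
          ≈⟨ +-cong (*-congˡ (⟦x₀⟧ t)) (tail i′ t) ⟩
        m₀ * (⟦ ε ⟧ t * ⟦ b r ⟧ t - s t) + ⟦ a ⟧ t * s′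
          ≈⟨ solve 6 (λ m e b s a s′ → m :* (e :* b :- s) :+ a :* s′ := a :* s′ :- m :* s :+ m :* (e :* b)) refl m₀ (⟦ ε ⟧ t) (⟦ b r ⟧ t) (s t) (⟦ a ⟧ t) s′ ⟩
        ⟦ a ⟧ t * s′ - m₀ * s t + m₀ * (⟦ ε ⟧ t * ⟦ b r ⟧ t)
          ≈⟨ +-congʳ (trans (sym (reduced-row i (λ k → ⟦ y k ⟧ t) t)) (reduced≈ t i)) ⟩
        ⟦ ε ⟧ t * ⟦ (a *ₚ b i′) -ₚ′ (M i′ zero *ₚ b r) ⟧ t + m₀ * (⟦ ε ⟧ t * ⟦ b r ⟧ t)
          ≈⟨ +-congʳ (*-congˡ (trans (⟦-ₚ′⟧ (a *ₚ b i′) (M i′ zero *ₚ b r) t) (+-cong (⟦*ₚ⟧ a (b i′) t) (-‿cong (⟦*ₚ⟧ (M i′ zero) (b r) t))))) ⟩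
        ⟦ ε ⟧ t * (⟦ a ⟧ t * ⟦ b i′ ⟧ t - m₀ * ⟦ b r ⟧ t) + m₀ * (⟦ ε ⟧ t * ⟦ b r ⟧ t)
          ≈⟨ solve 5 (λ e a c m b → e :* (a :* c :- m :* b) :+ m :* (e :* b) := a :* e :* c) refl (⟦ ε ⟧ t) (⟦ a ⟧ t) (⟦ b i′ ⟧ t) m₀ (⟦ b r ⟧ t) ⟩
        ⟦ a ⟧ t * ⟦ ε ⟧ t * ⟦ b i′ ⟧ t    ≈⟨ *-congʳ (⟦*ₚ⟧ a ε t) ⟨
        ⟦ a *ₚ ε ⟧ t * ⟦ b i′ ⟧ t         ∎
        where
        i′ : Fin (suc n)
        i′ = punchIn r i
        m₀ s′ : Carrier
        m₀ = ⟦ M i′ zero ⟧ t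
        s′ = ∑[ k < n ] (⟦ M i′ (suc k) ⟧ t * ⟦ y k ⟧ t)

  singular⊎solvable : ∀ {n} (M : PolyMatrix n) → SingularAt M ⊎ SolvableNear M
  singular⊎solvable {zero} M = inj₂ λ b → (λ ()) , 1# ∷ [] , (λ 1≈0 → 1≉0 (trans (sym (⟦const⟧ 1# μ)) 1≈0)) , λ _ ()
  singular⊎solvable {suc n} M with any? (λ i → ¬? (⟦ M i zero ⟧ μ ≈? 0#))
  ... | yes (r , pivot) = lift (singular⊎solvable reduced)
    where
    open Pivot M r pivot
    lift : SingularAt reduced ⊎ SolvableNear reduced → SingularAt M ⊎ SolvableNear M
    lift (inj₁ sing) = inj₁ (singular sing)
    lift (inj₂ solv) = inj₂ (solvable solv)
  ... | no  noPivot = inj₁ (e₀ , (zero , 1≉0) , row)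
    where
    e₀ : Vector Carrier (suc n)
    e₀ zero    = 1#
    e₀ (suc _) = 0#
    column≈0 : ∀ i → ⟦ M i zero ⟧ μ ≈ 0#
    column≈0 i with ⟦ M i zero ⟧ μ ≈? 0#
    ... | yes ≈0 = ≈0
    ... | no  ≉0 = contradiction (i , ≉0) noPivot
    row : ∀ i → ⟦ M i zero ⟧ μ * 1# + ∑[ k < n ] (⟦ M i (suc k) ⟧ μ * 0#) ≈ 0#
    row i = trans (+-cong (trans (*-identityʳ _) (column≈0 i)) (sum-zero (λ k → zeroʳ (⟦ M i (suc k) ⟧ μ)))) (+-identityˡ _)

-- Unicyclic graphs as a cycle with rooted trees

injective⇒surjective : ∀ {m n} (f : Fin m → Fin n) → Injective _≡_ _≡_ f → n ℕ.≤ m → ∀ j → ∃[ i ] f i ≡ j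
injective⇒surjective {m} {suc n} f f-injective n<m j with any? (λ i → f i ≟ j)
... | yes preimage = preimage
... | no  missed   = contradiction (ℕₚ.≤-trans n<m (injective⇒≤ f∖j-injective)) ℕₚ.1+n≰n
  where
  f∖j : Fin m → Fin n
  f∖j i = punchOut {i = j} {j = f i} (λ j≡fi → missed (i , ≡.sym j≡fi))

  f∖j-injective : Injective _≡_ _≡_ f∖j
  f∖j-injective {x} {y} eq = f-injective (punchOut-injective {i = j} (λ j≡fi → missed (x , ≡.sym j≡fi)) (λ j≡fi → missed (y , ≡.sym j≡fi)) eq)

Least : (ℕ → Set) → Set
Least P = Σ[ n ∈ ℕ ] P n × (∀ m → m ℕ.< n → ¬ P m)

least : {P : ℕ → Set} → (∀ n → Dec (P n)) → ∀ n → P n → Least P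
least P? n Pn with P? 0
... | yes P0 = 0 , P0 , λ _ ()
least P? zero    P0 | no ¬P0 = contradiction P0 ¬P0
least P? (suc n) Pn | no ¬P0 with least (P? ∘ suc) n Pn
... | m , Pm , below = suc m , Pm , λ { zero _ → ¬P0 ; (suc k) (s≤s k<m) → below k k<m }

module Structure (G : Unicyclic) where
  open ≡ using (refl; sym; trans; cong; subst)
  open Unicyclic G

  toℕ-mod : ∀ k → toℕ (k mod g) ≡ k % g
  toℕ-mod k = toℕ-fromℕ< (m%n<n k g)

  %⇒mod : ∀ {k l} → k % g ≡ l % g → k mod g ≡ l mod g
  %⇒mod {k} {l} eq = toℕ-injective (trans (toℕ-mod k) (trans eq (sym (toℕ-mod l))))

  mod⇒% : ∀ {k l} → k mod g ≡ l mod g → k % g ≡ l % g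
  mod⇒% {k} {l} eq = trans (sym (toℕ-mod k)) (trans (cong toℕ eq) (toℕ-mod l))

  toℕ-mod-inverse : ∀ j → toℕ j mod g ≡ j
  toℕ-mod-inverse j = toℕ-injective (trans (toℕ-mod (toℕ j)) (m<n⇒m%n≡m (toℕ<n j)))

  suc-% : ∀ k → suc (k % g) % g ≡ suc k % g
  suc-% k = trans (sym ([m+kn]%n≡m%n (suc (k % g)) (k ℕ./ g) g)) (cong (λ l → suc l % g) (sym (m≡m%n+[m/n]*n k g)))

  suc-mod-cong : ∀ {k l} → k mod g ≡ l mod g → suc k mod g ≡ suc l mod g
  suc-mod-cong {k} {l} eq = %⇒mod (trans (sym (suc-% k)) (trans (cong (λ m → suc m % g) (mod⇒% {k} {l} eq)) (suc-% l)))

  private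
    suc-pred-g : suc (ℕ.pred g) ≡ g
    suc-pred-g = ℕₚ.suc-pred g

    wrap : ∀ k → (suc k ℕ.+ ℕ.pred g) % g ≡ k % g
    wrap k = begin
      (suc k ℕ.+ ℕ.pred g) % g   ≡⟨ cong (_% g) (ℕₚ.+-suc k (ℕ.pred g)) ⟨
      (k ℕ.+ suc (ℕ.pred g)) % g ≡⟨ cong (λ l → (k ℕ.+ l) % g) suc-pred-g ⟩
      (k ℕ.+ g) % g              ≡⟨ [m+n]%n≡m%n k g ⟩
      k % g                      ∎
      where open ≡.≡-Reasoning

  suc-mod-injective : ∀ {k l} → suc k mod g ≡ suc l mod g → k mod g ≡ l mod g
  suc-mod-injective {k} {l} eq = %⇒mod (begin
    k % g                                      ≡⟨ wrap k ⟨
    (suc k ℕ.+ ℕ.pred g) % g                   ≡⟨ %-distribˡ-+ (suc k) (ℕ.pred g) g ⟩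
    (suc k % g ℕ.+ ℕ.pred g % g) % g           ≡⟨ cong (λ r → (r ℕ.+ ℕ.pred g % g) % g) (mod⇒% {suc k} {suc l} eq) ⟩
    (suc l % g ℕ.+ ℕ.pred g % g) % g           ≡⟨ %-distribˡ-+ (suc l) (ℕ.pred g) g ⟨
    (suc l ℕ.+ ℕ.pred g) % g                   ≡⟨ wrap l ⟩
    l % g                                      ∎)
    where open ≡.≡-Reasoning

  pred-mod : ∀ j → ∃[ k ] suc k mod g ≡ j
  pred-mod j = toℕ j ℕ.+ ℕ.pred g , trans (%⇒mod (wrap (toℕ j))) (toℕ-mod-inverse j)

  +-mod-≢ : ∀ k {a} → 0 ℕ.< a → a ℕ.< g → (k ℕ.+ a) mod g ≢ k mod g
  +-mod-≢ zero    {a} 0<a a<g eq = ℕₚ.<⇒≢ 0<a (sym (begin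
    a      ≡⟨ m<n⇒m%n≡m a<g ⟨
    a % g  ≡⟨ mod⇒% {a} {0} eq ⟩
    0 % g  ≡⟨ m<n⇒m%n≡m (ℕₚ.<-trans 0<a a<g) ⟩
    0      ∎))
    where open ≡.≡-Reasoning
  +-mod-≢ (suc k) 0<a a<g eq = +-mod-≢ k 0<a a<g (suc-mod-injective eq)

  suc-mod-≢ : ∀ k → suc k mod g ≢ k mod g
  suc-mod-≢ k eq = +-mod-≢ k {1} z<s (ℕₚ.≤-trans (s≤s (s≤s z≤n)) g≥3) (trans (cong (_mod g) (ℕₚ.+-comm k 1)) eq)

  suc-suc-mod-≢ : ∀ k → suc (suc k) mod g ≢ k mod g
  suc-suc-mod-≢ k eq = +-mod-≢ k {2} z<s g≥3 (trans (cong (_mod g) (ℕₚ.+-comm k 2)) eq)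

  joins-sym : ∀ {e x y} → Joins e x y → Joins e y x
  joins-sym (inj₁ p) = inj₂ p
  joins-sym (inj₂ p) = inj₁ p

  joins-src-tgt : ∀ e → Joins e (src e) (tgt e)
  joins-src-tgt e = inj₁ (refl , refl)

  joins-∈ˡ : ∀ {e x y} → Joins e x y → x ∈ₑ e
  joins-∈ˡ (inj₁ (refl , _)) = inj₁ refl
  joins-∈ˡ (inj₂ (_ , refl)) = inj₂ refl

  joins-∈ʳ : ∀ {e x y} → Joins e x y → y ∈ₑ e
  joins-∈ʳ = joins-∈ˡ ∘ joins-sym

  joins-endpoint : ∀ {e x y z} → Joins e x y → z ∈ₑ e → z ≡ x ⊎ z ≡ y
  joins-endpoint (inj₁ (refl , refl)) z∈e         = z∈e
  joins-endpoint (inj₂ (refl , refl)) (inj₁ z≡s)  = inj₂ z≡s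
  joins-endpoint (inj₂ (refl , refl)) (inj₂ z≡t)  = inj₁ z≡t

  joins-≢ : ∀ {e x y} → Joins e x y → x ≢ y
  joins-≢ {e} (inj₁ (refl , refl)) = loopless e
  joins-≢ {e} (inj₂ (refl , refl)) = loopless e ∘ sym

  joins-opposite : ∀ {e x} → x ∈ₑ e → Joins e x (opposite e x)
  joins-opposite {e} {x} x∈e with src e ≟ x
  ... | yes src≡x = inj₁ (src≡x , refl)
  joins-opposite {e} {x} (inj₁ x≡src) | no src≢x = contradiction (sym x≡src) src≢x
  joins-opposite {e} {x} (inj₂ x≡tgt) | no src≢x = inj₂ (refl , sym x≡tgt)

  joins-uniqueʳ : ∀ {e x y z} → Joins e x y → Joins e x z → y ≡ z
  joins-uniqueʳ Jy Jz with joins-endpoint Jz (joins-∈ʳ Jy)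
  ... | inj₁ y≡x = contradiction (sym y≡x) (joins-≢ Jy)
  ... | inj₂ y≡z = y≡z

  joins? : ∀ e x y → Dec (Joins e x y)
  joins? e x y = ((src e ≟ x) ×-dec (tgt e ≟ y)) ⊎-dec ((src e ≟ y) ×-dec (tgt e ≟ x))

  OnCycle : Pred V _
  OnCycle x = ∃[ j ] v j ≡ x

  onCycle? : Decidable OnCycle
  onCycle? x = any? (λ j → v j ≟ x)

  v∈c : ∀ k → v ⟨ k ⟩ ∈ₑ c ⟨ k ⟩
  v∈c k with pred-mod (k mod g)
  ... | l , eq = subst (λ j → v j ∈ₑ c j) eq (joins-∈ʳ (c-joins l))

  v∈c-suc : ∀ k → v ⟨ k ⟩ ∈ₑ c ⟨ suc k ⟩
  v∈c-suc k = joins-∈ˡ (c-joins k)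

  c-endpoint : ∀ j {x} → x ∈ₑ c j → OnCycle x
  c-endpoint j x∈c with pred-mod j
  ... | l , refl with joins-endpoint (c-joins l) x∈c
  ...   | inj₁ x≡ = _ , sym x≡
  ...   | inj₂ x≡ = _ , sym x≡

  c-at-v : ∀ k j → v ⟨ k ⟩ ∈ₑ c j → j ≡ k mod g ⊎ j ≡ suc k mod g
  c-at-v k j v∈ with pred-mod j
  ... | l , refl with joins-endpoint (c-joins l) v∈
  ...   | inj₁ eq = inj₂ (suc-mod-cong {l} {k} (sym (v-injective eq)))
  ...   | inj₂ eq = inj₁ (sym (v-injective eq))

  c-injective : Injective _≡_ _≡_ c
  c-injective {i} {j} ci≡cj with pred-mod i
  ... | k , refl with c-at-v k j (subst (v ⟨ k ⟩ ∈ₑ_) ci≡cj (v∈c-suc k))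
  ...   | inj₂ eq = sym eq
  ...   | inj₁ refl with c-at-v (suc k) (k mod g) (subst (v ⟨ suc k ⟩ ∈ₑ_) ci≡cj (v∈c (suc k)))
  ...     | inj₁ eq = sym eq
  ...     | inj₂ eq = contradiction (sym eq) (suc-suc-mod-≢ k)

  offCycle⇒pendant : ∀ {x e} → ¬ OnCycle x → x ∈ₑ e → Pendant e
  offCycle⇒pendant x∉ x∈e (j , refl) = x∉ (c-endpoint j x∈e)

  Reach : ℕ → V → Set
  Reach zero    x = OnCycle x
  Reach (suc n) x = ∃[ e ] ∃[ y ] Joins e x y × Reach n y

  reach? : ∀ n x → Dec (Reach n x)
  reach? zero    x = onCycle? x
  reach? (suc n) x = any? λ e → any? λ y → joins? e x y ×-dec reach? n y

  walk⇒reach : ∀ {P x y} → Walk P x y → OnCycle y → ∃[ n ] Reach n x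
  walk⇒reach nil                 y∈ = 0 , y∈
  walk⇒reach ((e , _ , J) ◅ w) y∈ with walk⇒reach w y∈
  ... | n , reach = suc n , e , _ , J , reach

  abstract
    least-reach : ∀ x → Least (λ n → Reach n x)
    least-reach x with walk⇒reach (connected x (v ⟨ 0 ⟩)) (0 mod g , refl)
    ... | n , reach = least (λ n → reach? n x) n reach

  dist : V → ℕ
  dist x = proj₁ (least-reach x)

  dist-least : ∀ {n x} → Reach n x → dist x ℕ.≤ n
  dist-least {n} {x} reach = ℕₚ.≮⇒≥ λ n<dist → proj₂ (proj₂ (least-reach x)) n n<dist reach

  onCycle⇒dist≡0 : ∀ {x} → OnCycle x → dist x ≡ 0
  onCycle⇒dist≡0 x∈ = ℕₚ.n≤0⇒n≡0 (dist-least x∈)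

  dist≡suc⇒offCycle : ∀ {x n} → dist x ≡ suc n → ¬ OnCycle x
  dist≡suc⇒offCycle eq x∈ = contradiction (trans (sym eq) (onCycle⇒dist≡0 x∈)) λ ()

  Parent : V → E → V → Set
  Parent x e y = Joins e x y × dist x ≡ suc (dist y)

  parent : ∀ x → OnCycle x ⊎ (∃[ e ] ∃[ y ] Parent x e y)
  parent x with least-reach x
  ... | zero  , x∈ , _ = inj₁ x∈
  ... | suc n , (e , y , J , reach) , below = inj₂ (e , y , J ,
    cong suc (ℕₚ.≤-antisym
      (ℕₚ.≮⇒≥ λ dy<n → below (suc (dist y)) (s≤s dy<n) (e , y , J , proj₁ (proj₂ (least-reach y))))
      (dist-least reach)))

  -- The parent edge of a vertex off the cycle, and c_j at v_j.
  up-edge : V → E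
  up-edge x = [ c ∘ proj₁ , proj₁ ]′ (parent x)

  up : V → V
  up x = [ (λ _ → x) , proj₁ ∘ proj₂ ]′ (parent x)

  offCycle⇒parent : ∀ {x} → ¬ OnCycle x → Parent x (up-edge x) (up x)
  offCycle⇒parent {x} x∉ with parent x
  ... | inj₁ x∈            = contradiction x∈ x∉
  ... | inj₂ (_ , _ , par) = par

  onCycle⇒cycle-edge : ∀ {x} → OnCycle x → ∃[ j ] c j ≡ up-edge x
  onCycle⇒cycle-edge {x} x∈ with parent x
  ... | inj₁ (j , _)         = j , refl
  ... | inj₂ (_ , _ , _ , d) = contradiction x∈ (dist≡suc⇒offCycle d)

  up-edge-injective : Injective _≡_ _≡_ up-edge
  up-edge-injective {x} {y} eq with parent x | parent y
  ... | inj₁ (i , vi≡x) | inj₁ (j , vj≡y) = trans (sym vi≡x) (trans (cong v (c-injective eq)) vj≡y)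
  ... | inj₁ (i , vi≡x) | inj₂ (_ , _ , J , d) =
    contradiction (c-endpoint i (subst (y ∈ₑ_) (sym eq) (joins-∈ˡ J))) (dist≡suc⇒offCycle d)
  ... | inj₂ (_ , _ , J , d) | inj₁ (j , vj≡y) =
    contradiction (c-endpoint j (subst (x ∈ₑ_) eq (joins-∈ˡ J))) (dist≡suc⇒offCycle d)
  ... | inj₂ (e , x′ , J , d) | inj₂ (_ , y′ , J′ , d′) with refl ← eq with joins-endpoint J (joins-∈ˡ J′)
  ...   | inj₁ y≡x  = sym y≡x
  ...   | inj₂ refl with joins-uniqueʳ (joins-sym J) J′
  ...     | refl = contradiction (trans d (cong suc d′)) (ℕₚ.<⇒≢ (ℕₚ.m≤n⇒m≤1+n ℕₚ.≤-refl))

  -- By |E| = |V|, the injection up-edge is onto.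
  pendant-parent : ∀ {e x y} → Pendant e → Joins e x y →
                   (up-edge x ≡ e × Parent x e y) ⊎ (up-edge y ≡ e × Parent y e x)
  pendant-parent {e} {x} {y} pend J
    with injective⇒surjective up-edge up-edge-injective (ℕₚ.≤-reflexive |E|≡|V|) e
  ... | z , up≡e with onCycle? z
  ...   | yes z∈ = contradiction (subst (λ e → ∃[ j ] c j ≡ e) up≡e (onCycle⇒cycle-edge z∈)) pend
  ...   | no  z∉ with offCycle⇒parent z∉
  ...     | J′ , d rewrite up≡e with joins-endpoint J (joins-∈ˡ J′)
  ...       | inj₁ refl = inj₁ (up≡e , J , trans d (cong (suc ∘ dist) (joins-uniqueʳ J′ J)))
  ...       | inj₂ refl = inj₂ (up≡e , joins-sym J , trans d (cong (suc ∘ dist) (joins-uniqueʳ J′ (joins-sym J))))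

  dist-up : ∀ x → dist (up x) ≡ dist x ℕ.∸ 1
  dist-up x with onCycle? x
  ... | no x∉ = sym (cong (ℕ._∸ 1) (proj₂ (offCycle⇒parent x∉)))
  ... | yes x∈ with parent x
  ...   | inj₁ _ = trans (onCycle⇒dist≡0 x∈) (cong (ℕ._∸ 1) (sym (onCycle⇒dist≡0 x∈)))
  ...   | inj₂ (_ , _ , _ , d) = contradiction x∈ (dist≡suc⇒offCycle d)

  climb : ℕ → V → V
  climb zero    x = x
  climb (suc n) x = climb n (up x)

  dist-climb : ∀ n x → dist (climb n x) ≡ dist x ℕ.∸ n
  dist-climb zero    x = refl
  dist-climb (suc n) x = trans (dist-climb n (up x)) (trans (cong (ℕ._∸ n) (dist-up x)) (ℕₚ.∸-+-assoc (dist x) 1 n))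

  dist<order : ∀ x → dist x ℕ.< order
  dist<order x = ℕₚ.≰⇒> λ order≤dist → repeat order≤dist (pigeonhole (ℕₚ.n<1+n order) (λ i → climb (toℕ i) x))
    where
    repeat : order ℕ.≤ dist x → ¬ (∃[ i ] ∃[ j ] toℕ i ℕ.< toℕ j × climb (toℕ {suc order} i) x ≡ climb (toℕ {suc order} j) x)
    repeat order≤dist (i , j , i<j , eq) = ℕₚ.<⇒≢ i<j (ℕₚ.∸-cancelˡ-≡ (bound i) (bound j) (begin
      dist x ℕ.∸ toℕ i          ≡⟨ dist-climb (toℕ i) x ⟨
      dist (climb (toℕ i) x)    ≡⟨ cong dist eq ⟩
      dist (climb (toℕ j) x)    ≡⟨ dist-climb (toℕ j) x ⟩
      dist x ℕ.∸ toℕ j          ∎))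
      where
      open ≡.≡-Reasoning
      bound : ∀ (i : Fin (suc order)) → toℕ i ℕ.≤ dist x
      bound i = ℕₚ.≤-trans (ℕₚ.≤-pred (toℕ<n i)) order≤dist

  root : V → V
  root x = climb (dist x) x

  root-onCycle : ∀ x → OnCycle (root x)
  root-onCycle x with onCycle? (root x)
  ... | yes r∈ = r∈
  ... | no  r∉ = contradiction (trans (sym (proj₂ (offCycle⇒parent r∉))) (trans (dist-climb (dist x) x) (ℕₚ.n∸n≡0 (dist x)))) λ ()

  root-v : ∀ j → root (v j) ≡ v j
  root-v j = cong (λ n → climb n (v j)) (onCycle⇒dist≡0 (j , refl))

  root-parent : ∀ {e x y} → up-edge x ≡ e → Parent x e y → root x ≡ root y
  root-parent {e} {x} {y} refl (J , d) = begin
    climb (dist x) x         ≡⟨ cong (λ n → climb n x) d ⟩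
    climb (dist y) (up x)    ≡⟨ cong (climb (dist y)) (joins-uniqueʳ (proj₁ (offCycle⇒parent (dist≡suc⇒offCycle d))) J) ⟩
    climb (dist y) y         ∎
    where open ≡.≡-Reasoning

  root-joins : ∀ {e x y} → Pendant e → Joins e x y → root x ≡ root y
  root-joins pend J with pendant-parent pend J
  ... | inj₁ (up≡ , par) = root-parent up≡ par
  ... | inj₂ (up≡ , par) = sym (root-parent up≡ par)

  root-∈ : ∀ {e x} → Pendant e → x ∈ₑ e → root x ≡ root (src e)
  root-∈ pend (inj₁ refl) = refl
  root-∈ {e} pend (inj₂ refl) = sym (root-joins pend (joins-src-tgt e))

  root-walk : ∀ {x y} → Walk Pendant x y → root x ≡ root y
  root-walk nil                    = refl
  root-walk ((_ , pend , J) ◅ w) = trans (root-joins pend J) (root-walk w)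

  walk-from-root : ∀ n x → dist x ≡ n → Walk Pendant (root x) x
  walk-from-root zero    x d = subst (λ m → Walk Pendant (climb m x) x) (sym d) nil
  walk-from-root (suc n) x d =
    subst (λ r → Walk Pendant r x) (sym (root-parent refl par))
      (walk-from-root n (up x) (ℕₚ.suc-injective (trans (sym (proj₂ par)) d))
        ◅◅ (up-edge x , offCycle⇒pendant x∉ (joins-∈ˡ (proj₁ par)) , joins-sym (proj₁ par)) ◅ nil)
    where
    x∉ : ¬ OnCycle x
    x∉ = dist≡suc⇒offCycle d
    par : Parent x (up-edge x) (up x)
    par = offCycle⇒parent x∉

  inTree⇒ : ∀ {j e} → InTree j e → Pendant e × root (src e) ≡ v j
  inTree⇒ {j} (pend , x , x∈e , w) = pend , trans (sym (root-∈ pend x∈e)) (trans (sym (root-walk w)) (root-v j))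

  inTree⇐ : ∀ {j e} → Pendant e → root (src e) ≡ v j → InTree j e
  inTree⇐ {j} {e} pend root≡ = pend , src e , inj₁ refl ,
    subst (λ r → Walk Pendant r (src e)) root≡ (walk-from-root _ (src e) refl)

  inTree? : ∀ j → Decidable (InTree j)
  inTree? j e = map′ (λ (pend , root≡) → inTree⇐ pend root≡) inTree⇒ (pendant? e ×-dec (root (src e) ≟ v j))

  pendant⇒inTree : ∀ {e} → Pendant e → ∃[ j ] InTree j e
  pendant⇒inTree {e} pend with root-onCycle (src e)
  ... | j , vj≡root = j , inTree⇐ pend (sym vj≡root)

  inTree-adjacent : ∀ {j e e′ x} → InTree j e → x ∈ₑ e → Pendant e′ → x ∈ₑ e′ → InTree j e′
  inTree-adjacent T x∈e pend′ x∈e′ with inTree⇒ T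
  ... | pend , root≡ = inTree⇐ pend′ (trans (sym (root-∈ pend′ x∈e′)) (trans (root-∈ pend x∈e) root≡))

  inTree-at-v : ∀ {j e} → Pendant e → v j ∈ₑ e → InTree j e
  inTree-at-v {j} pend v∈e = inTree⇐ pend (trans (sym (root-∈ pend v∈e)) (root-v j))

  inTree-root : ∀ {i j e} → InTree j e → v i ∈ₑ e → i ≡ j
  inTree-root {i} T v∈e with inTree⇒ T
  ... | pend , root≡ = v-injective (trans (sym (root-v i)) (trans (root-∈ pend v∈e) root≡))

  inTree-unique : ∀ {i j e} → InTree i e → InTree j e → i ≡ j
  inTree-unique T T′ = v-injective (trans (sym (proj₂ (inTree⇒ T))) (proj₂ (inTree⇒ T′)))

-- The rows of the Ricci matrix

module Rows (ℝ : Reals) (G : Unicyclic) where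
  open Sums ℝ public
  open Unicyclic G public
  open Ricci ℝ G public using (d; ricci; term; h; γ; feedback; σ; constℕ; AvoidsTree; Eliminates; module Cycle)
  open LinearAlgebra ℝ public
  open Structure G public

  [_]·_ : Bool → Carrier → Carrier
  [ b ]· x = if b then x else 0#

  private
    variable
      A : Set

  if-yes : ∀ {P : Set} (P? : Dec P) {x y : A} → P → (if does P? then x else y) ≡ x
  if-yes P? p rewrite dec-true P? p = ≡.refl

  if-no : ∀ {P : Set} (P? : Dec P) {x y : A} → ¬ P → (if does P? then x else y) ≡ y
  if-no P? ¬p rewrite dec-false P? ¬p = ≡.refl

  ∑-endpoints : ∀ e (f : V → Carrier) → ∑[ x < order ] ([ does (x ∈ₑ? e) ]· f x) ≈ f (src e) + f (tgt e)
  ∑-endpoints e f = begin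
    ∑[ x < order ] ([ does (x ∈ₑ? e) ]· f x)
      ≈⟨ sum-cong-≋ pointwise ⟩
    ∑[ x < order ] ([ does (src e ≟ x) ]· f x + [ does (tgt e ≟ x) ]· f x)
      ≈⟨ ∑-distrib-+ (λ x → [ does (src e ≟ x) ]· f x) (λ x → [ does (tgt e ≟ x) ]· f x) ⟩
    ∑[ x < order ] ([ does (src e ≟ x) ]· f x) + ∑[ x < order ] ([ does (tgt e ≟ x) ]· f x)
      ≈⟨ +-cong (∑-indicator (src e) f) (∑-indicator (tgt e) f) ⟩
    f (src e) + f (tgt e) ∎
    where
    pointwise : ∀ x → [ does (x ∈ₑ? e) ]· f x ≈ [ does (src e ≟ x) ]· f x + [ does (tgt e ≟ x) ]· f x
    pointwise x with src e ≟ x | tgt e ≟ x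
    ... | yes s≡x    | yes t≡x = contradiction (≡.trans s≡x (≡.sym t≡x)) (loopless e)
    ... | yes ≡.refl | no _    = trans (reflexive (if-yes (x ∈ₑ? e) (inj₁ ≡.refl))) (sym (+-identityʳ _))
    ... | no _ | yes ≡.refl    = trans (reflexive (if-yes (x ∈ₑ? e) (inj₂ ≡.refl))) (sym (+-identityˡ _))
    ... | no s≢x | no t≢x      = trans (reflexive (if-no (x ∈ₑ? e) λ { (inj₁ x≡s) → s≢x (≡.sym x≡s) ; (inj₂ x≡t) → t≢x (≡.sym x≡t) })) (sym (+-identityˡ _))

  Star∑ : Vector Carrier size → V → Carrier
  Star∑ z x = ∑[ e < size ] ([ does (x ∈ₑ? e) ]· z e)

  r : V → Carrier
  r x = 1# ÷ d x

  Row : Carrier → Vector Carrier size → E → V → V → Set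
  Row t z e x y = r x * Star∑ z x + r y * Star∑ z y ≈ (t + (1# + 1#) * (r x + r y)) * z e

  ricci-· : ∀ z e → (ricci · z) e ≈
    r (src e) * Star∑ z (src e) + r (tgt e) * Star∑ z (tgt e) - (1# + 1#) * (r (src e) + r (tgt e)) * z e
  ricci-· z e = begin
    ∑[ e′ < size ] (ricci e e′ * z e′)
      ≈⟨ sum-cong-≋ entry ⟩
    ∑[ e′ < size ] (common e′ - [ does (e ≟ e′) ]· (2R * z e′))
      ≈⟨ ∑-distrib-sub common (λ e′ → [ does (e ≟ e′) ]· (2R * z e′)) ⟩
    ∑[ e′ < size ] common e′ - ∑[ e′ < size ] ([ does (e ≟ e′) ]· (2R * z e′))
      ≈⟨ +-cong (trans (∑-comm (λ e′ x → [ does (x ∈ₑ? e) ]· (r x * [ does (x ∈ₑ? e′) ]· z e′)))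
                       (sum-cong-≋ (λ x → factor (does (x ∈ₑ? e)) (r x) (λ e′ → [ does (x ∈ₑ? e′) ]· z e′))))
                (-‿cong (∑-indicator e (λ e′ → 2R * z e′))) ⟩
    ∑[ x < order ] ([ does (x ∈ₑ? e) ]· (r x * Star∑ z x)) - 2R * z e
      ≈⟨ +-congʳ (∑-endpoints e (λ x → r x * Star∑ z x)) ⟩
    r (src e) * Star∑ z (src e) + r (tgt e) * Star∑ z (tgt e) - 2R * z e ∎
    where
    R 2R : Carrier
    R  = r (src e) + r (tgt e)
    2R = (1# + 1#) * R

    common : Vector Carrier size
    common e′ = ∑[ x < order ] ([ does (x ∈ₑ? e) ]· (r x * [ does (x ∈ₑ? e′) ]· z e′))

    factor : ∀ b a (f : Vector Carrier size) → ∑[ i < size ] ([ b ]· (a * f i)) ≈ [ b ]· (a * sum f)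
    factor true  a f = sym (*-distribˡ-sum a f)
    factor false a f = sum-zero {f = λ (_ : Fin size) → 0#} (λ _ → refl)

    both : ∀ a b c w → ([ a ∧ b ]· c) * w ≈ [ a ]· (c * [ b ]· w)
    both true  true  c w = refl
    both true  false c w = trans (zeroˡ w) (sym (zeroʳ c))
    both false _     c w = zeroˡ w

    entry : ∀ e′ → ricci e e′ * z e′ ≈ common e′ - [ does (e ≟ e′) ]· (2R * z e′)
    entry e′ with e ≟ e′
    ... | yes ≡.refl = sym (begin
      common e - 2R * z e
        ≈⟨ +-congʳ (∑-endpoints e (λ x → r x * [ does (x ∈ₑ? e) ]· z e)) ⟩
      r (src e) * [ does (src e ∈ₑ? e) ]· z e + r (tgt e) * [ does (tgt e ∈ₑ? e) ]· z e - 2R * z e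
        ≈⟨ +-congʳ (+-cong (*-congˡ (reflexive (if-yes (src e ∈ₑ? e) (inj₁ ≡.refl)))) (*-congˡ (reflexive (if-yes (tgt e ∈ₑ? e) (inj₂ ≡.refl))))) ⟩
      r (src e) * z e + r (tgt e) * z e - 2R * z e
        ≈⟨ solve 3 (λ p q z → p :* z :+ q :* z :- con (+ 2) :* (p :+ q) :* z := (:- (p :+ q)) :* z) refl (r (src e)) (r (tgt e)) (z e) ⟩
      - R * z e ∎)
    ... | no e≢e′ = begin
      ∑[ x < order ] ([ does (x ∈ₑ? e) ∧ does (x ∈ₑ? e′) ]· r x) * z e′
        ≈⟨ *-comm _ _ ⟩
      z e′ * ∑[ x < order ] ([ does (x ∈ₑ? e) ∧ does (x ∈ₑ? e′) ]· r x)
        ≈⟨ *-distribˡ-sum (z e′) (λ x → [ does (x ∈ₑ? e) ∧ does (x ∈ₑ? e′) ]· r x) ⟩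
      ∑[ x < order ] (z e′ * ([ does (x ∈ₑ? e) ∧ does (x ∈ₑ? e′) ]· r x))
        ≈⟨ sum-cong-≋ (λ x → trans (*-comm _ _) (both (does (x ∈ₑ? e)) (does (x ∈ₑ? e′)) (r x) (z e′))) ⟩
      common e′
        ≈⟨ solve 1 (λ x → x := x :- con (+ 0)) refl (common e′) ⟩
      common e′ - 0# ∎

  ricci-joins : ∀ z {e x y} → Joins e x y → (ricci · z) e ≈
    r x * Star∑ z x + r y * Star∑ z y - (1# + 1#) * (r x + r y) * z e
  ricci-joins z {e} (inj₁ (≡.refl , ≡.refl)) = ricci-· z e
  ricci-joins z {e} (inj₂ (≡.refl , ≡.refl)) = trans (ricci-· z e)
    (solve 5 (λ p s q u z → p :* s :+ q :* u :- con (+ 2) :* (p :+ q) :* z := q :* u :+ p :* s :- con (+ 2) :* (q :+ p) :* z) refl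
      (r (src e)) (Star∑ z (src e)) (r (tgt e)) (Star∑ z (tgt e)) (z e))

  solves⇒row : ∀ t z {e x y} → Joins e x y → (ricci · z) e ≈ t * z e → Row t z e x y
  solves⇒row t z {e} {x} {y} J eq = begin
    r x * Star∑ z x + r y * Star∑ z y
      ≈⟨ solve 2 (λ s u → s := s :- u :+ u) refl _ ((1# + 1#) * (r x + r y) * z e) ⟩
    r x * Star∑ z x + r y * Star∑ z y - (1# + 1#) * (r x + r y) * z e + (1# + 1#) * (r x + r y) * z e
      ≈⟨ +-congʳ (trans (sym (ricci-joins z J)) eq) ⟩
    t * z e + (1# + 1#) * (r x + r y) * z e
      ≈⟨ distribʳ _ _ _ ⟨
    (t + (1# + 1#) * (r x + r y)) * z e ∎

  row⇒solves : ∀ t z {e x y} → Joins e x y → Row t z e x y → (ricci · z) e ≈ t * z e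
  row⇒solves t z {e} {x} {y} J row = begin
    (ricci · z) e
      ≈⟨ ricci-joins z J ⟩
    r x * Star∑ z x + r y * Star∑ z y - (1# + 1#) * (r x + r y) * z e
      ≈⟨ +-congʳ row ⟩
    (t + (1# + 1#) * (r x + r y)) * z e - (1# + 1#) * (r x + r y) * z e
      ≈⟨ solve 3 (λ t a z → (t :+ a) :* z :- a :* z := t :* z) refl t ((1# + 1#) * (r x + r y)) (z e) ⟩
    t * z e ∎

  ricci-local : ∀ {z z′} e → z e ≈ z′ e → (∀ x → x ∈ₑ e → Star∑ z x ≈ Star∑ z′ x) → (ricci · z) e ≈ (ricci · z′) e
  ricci-local {z} {z′} e z≈ S≈ = begin
    (ricci · z) e     ≈⟨ ricci-· z e ⟩
    _                 ≈⟨ +-cong (+-cong (*-congˡ (S≈ (src e) (inj₁ ≡.refl))) (*-congˡ (S≈ (tgt e) (inj₂ ≡.refl)))) (-‿cong (*-congˡ z≈)) ⟩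
    _                 ≈⟨ ricci-· z′ e ⟨
    (ricci · z′) e    ∎

  []·-cong : ∀ {P : Set} (P? : Dec P) {x y} → (P → x ≈ y) → [ does P? ]· x ≈ [ does P? ]· y
  []·-cong (yes p) eq = eq p
  []·-cong (no _)  eq = refl

  Star∑-cong : ∀ {z z′} x → (∀ e → x ∈ₑ e → z e ≈ z′ e) → Star∑ z x ≈ Star∑ z′ x
  Star∑-cong x eq = sum-cong-≋ (λ e → []·-cong (x ∈ₑ? e) (eq e))

  σ-cong : ∀ {z z′} x → (∀ e → PendantAt x e → z e ≈ z′ e) → σ z x ≈ σ z′ x
  σ-cong x eq = sum-cong-≋ (λ e → []·-cong (pendantAt? x e) (eq e))

  children∑ : Vector Carrier size → E → V → Carrier
  children∑ z e x = ∑[ e′ < size ] ([ does (pendantAt? x e′ ×-dec ¬? (e ≟ e′)) ]· z e′)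

  Star∑-offCycle : ∀ z {e x} → ¬ OnCycle x → x ∈ₑ e → Star∑ z x ≈ z e + children∑ z e x
  Star∑-offCycle z {e} {x} x∉ x∈e = begin
    Star∑ z x
      ≈⟨ sum-cong-≋ pointwise ⟩
    ∑[ e′ < size ] ([ does (e ≟ e′) ]· z e′ + [ does (pendantAt? x e′ ×-dec ¬? (e ≟ e′)) ]· z e′)
      ≈⟨ ∑-distrib-+ (λ e′ → [ does (e ≟ e′) ]· z e′) (λ e′ → [ does (pendantAt? x e′ ×-dec ¬? (e ≟ e′)) ]· z e′) ⟩
    _ ≈⟨ +-congʳ (∑-indicator e z) ⟩
    z e + children∑ z e x ∎
    where
    pointwise : ∀ e′ → [ does (x ∈ₑ? e′) ]· z e′ ≈
      [ does (e ≟ e′) ]· z e′ + [ does (pendantAt? x e′ ×-dec ¬? (e ≟ e′)) ]· z e′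
    pointwise e′ = split (x ∈ₑ? e′) (e ≟ e′)
      where
      D = pendantAt? x e′ ×-dec ¬? (e ≟ e′)
      split : Dec (x ∈ₑ e′) → Dec (e ≡ e′) → [ does (x ∈ₑ? e′) ]· z e′ ≈ [ does (e ≟ e′) ]· z e′ + [ does D ]· z e′
      split (yes x∈) (yes e≡) = begin
        [ does (x ∈ₑ? e′) ]· z e′                   ≡⟨ if-yes (x ∈ₑ? e′) x∈ ⟩
        z e′                                        ≈⟨ +-identityʳ _ ⟨
        z e′ + 0#                                   ≡⟨ ≡.cong₂ _+_ (if-yes (e ≟ e′) e≡) (if-no D λ (_ , e≢) → e≢ e≡) ⟨
        [ does (e ≟ e′) ]· z e′ + [ does D ]· z e′  ∎
      split (yes x∈) (no e≢) = begin
        [ does (x ∈ₑ? e′) ]· z e′                   ≡⟨ if-yes (x ∈ₑ? e′) x∈ ⟩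
        z e′                                        ≈⟨ +-identityˡ _ ⟨
        0# + z e′                                   ≡⟨ ≡.cong₂ _+_ (if-no (e ≟ e′) e≢) (if-yes D ((offCycle⇒pendant x∉ x∈ , x∈) , e≢)) ⟨
        [ does (e ≟ e′) ]· z e′ + [ does D ]· z e′  ∎
      split (no x∉e′) _ = begin
        [ does (x ∈ₑ? e′) ]· z e′                   ≡⟨ if-no (x ∈ₑ? e′) x∉e′ ⟩
        0#                                          ≈⟨ +-identityˡ _ ⟨
        0# + 0#                                     ≡⟨ ≡.cong₂ _+_ (if-no (e ≟ e′) (λ e≡ → x∉e′ (≡.subst (x ∈ₑ_) e≡ x∈e))) (if-no D λ ((_ , x∈) , _) → x∉e′ x∈) ⟨
        [ does (e ≟ e′) ]· z e′ + [ does D ]· z e′  ∎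

  Star∑-v : ∀ z k → Star∑ z (v ⟨ k ⟩) ≈ z (c ⟨ k ⟩) + z (c ⟨ suc k ⟩) + σ z (v ⟨ k ⟩)
  Star∑-v z k = begin
    Star∑ z x
      ≈⟨ sum-cong-≋ pointwise ⟩
    ∑[ e < size ] (I₀ e + I₁ e + J e)
      ≈⟨ ∑-distrib-+ (λ e → I₀ e + I₁ e) J ⟩
    ∑[ e < size ] (I₀ e + I₁ e) + σ z x
      ≈⟨ +-congʳ (∑-distrib-+ I₀ I₁) ⟩
    sum I₀ + sum I₁ + σ z x
      ≈⟨ +-congʳ (+-cong (∑-indicator c₀ z) (∑-indicator c₁ z)) ⟩
    z c₀ + z c₁ + σ z x ∎
    where
    x = v ⟨ k ⟩
    c₀ = c ⟨ k ⟩
    c₁ = c ⟨ suc k ⟩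
    I₀ I₁ J : Vector Carrier size
    I₀ e = [ does (c₀ ≟ e) ]· z e
    I₁ e = [ does (c₁ ≟ e) ]· z e
    J e = [ does (pendantAt? x e) ]· z e
    c₀≢c₁ : c₀ ≢ c₁
    c₀≢c₁ eq = suc-mod-≢ k (≡.sym (c-injective eq))

    value : ∀ {e a₀ a₁ b} → I₀ e ≡ a₀ → I₁ e ≡ a₁ → J e ≡ b → I₀ e + I₁ e + J e ≈ a₀ + a₁ + b
    value p q s = reflexive (≡.cong₂ _+_ (≡.cong₂ _+_ p q) s)

    pointwise : ∀ e → [ does (x ∈ₑ? e) ]· z e ≈ I₀ e + I₁ e + J e
    pointwise e = split (c₀ ≟ e) (c₁ ≟ e) (pendantAt? x e)
      where
      split : Dec (c₀ ≡ e) → Dec (c₁ ≡ e) → Dec (PendantAt x e) → [ does (x ∈ₑ? e) ]· z e ≈ I₀ e + I₁ e + J e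
      split (yes p) (yes q) _ = contradiction (≡.trans p (≡.sym q)) c₀≢c₁
      split (yes p) (no q) _ = trans (reflexive (if-yes (x ∈ₑ? e) (≡.subst (x ∈ₑ_) p (v∈c k))))
        (trans (solve 1 (λ z → z := z :+ con (+ 0) :+ con (+ 0)) refl (z e))
          (sym (value (if-yes (c₀ ≟ e) p) (if-no (c₁ ≟ e) q) (if-no (pendantAt? x e) λ (pend , _) → pend (_ , p)))))
      split (no p) (yes q) _ = trans (reflexive (if-yes (x ∈ₑ? e) (≡.subst (x ∈ₑ_) q (v∈c-suc k))))
        (trans (solve 1 (λ z → z := con (+ 0) :+ z :+ con (+ 0)) refl (z e))
          (sym (value (if-no (c₀ ≟ e) p) (if-yes (c₁ ≟ e) q) (if-no (pendantAt? x e) λ (pend , _) → pend (_ , q)))))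
      split (no p) (no q) (yes s) = trans (reflexive (if-yes (x ∈ₑ? e) (proj₂ s)))
        (trans (solve 1 (λ z → z := con (+ 0) :+ con (+ 0) :+ z) refl (z e))
          (sym (value (if-no (c₀ ≟ e) p) (if-no (c₁ ≟ e) q) (if-yes (pendantAt? x e) s))))
      split (no p) (no q) (no s) = trans (reflexive (if-no (x ∈ₑ? e) off))
        (trans (solve 0 (con (+ 0) := con (+ 0) :+ con (+ 0) :+ con (+ 0)) refl)
          (sym (value (if-no (c₀ ≟ e) p) (if-no (c₁ ≟ e) q) (if-no (pendantAt? x e) s))))
        where
        off : ¬ x ∈ₑ e
        off x∈e = s ((λ (j , cj≡e) → on cj≡e (c-at-v k j (≡.subst (x ∈ₑ_) (≡.sym cj≡e) x∈e))) , x∈e)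
          where
          on : ∀ {j} → c j ≡ e → ¬ (j ≡ k mod g ⊎ j ≡ suc k mod g)
          on eq (inj₁ ≡.refl) = p eq
          on eq (inj₂ ≡.refl) = q eq

  0<d : ∀ {x e} → x ∈ₑ e → 0# < d x
  0<d {x} {e} x∈e = 0<fromℕ (filter-some (x ∈ₑ?_) (lose (∈-allFin e) x∈e))

  dr≈1 : ∀ {x e} → x ∈ₑ e → d x * r x ≈ 1#
  dr≈1 {x} x∈e = *-÷-cancel 1# (0<⇒≉0 (0<d x∈e))

  ·-combine : ∀ {n} (M : Matrix n) a (z y : Vector Carrier n) i →
              (M · (λ k → z k - a * y k)) i ≈ (M · z) i - a * (M · y) i
  ·-combine {n} M a z y i = begin
    ∑[ k < n ] (M i k * (z k - a * y k))
      ≈⟨ sum-cong-≋ (λ k → solve 4 (λ m z a y → m :* (z :- a :* y) := m :* z :- a :* (m :* y)) refl (M i k) (z k) a (y k)) ⟩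
    ∑[ k < n ] (M i k * z k - a * (M i k * y k))
      ≈⟨ ∑-distrib-sub (λ k → M i k * z k) (λ k → a * (M i k * y k)) ⟩
    (M · z) i - ∑[ k < n ] (a * (M i k * y k))
      ≈⟨ +-congˡ (-‿cong (*-distribˡ-sum a (λ k → M i k * y k))) ⟨
    (M · z) i - a * (M · y) i ∎

  solves-combine : ∀ {P t} a {z y} → SolvesOn P ricci t z → SolvesOn P ricci t y → SolvesOn P ricci t (λ e → z e - a * y e)
  solves-combine {t = t} a {z} {y} Sz Sy e Pe = begin
    (ricci · (λ k → z k - a * y k)) e    ≈⟨ ·-combine ricci a z y e ⟩
    (ricci · z) e - a * (ricci · y) e    ≈⟨ +-cong (Sz e Pe) (-‿cong (*-congˡ (Sy e Pe))) ⟩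
    t * z e - a * (t * y e)              ≈⟨ solve 4 (λ t z a y → t :* z :- a :* (t :* y) := t :* (z :- a :* y)) refl t (z e) a (y e) ⟩
    t * (z e - a * y e)                  ∎

  σ-combine : ∀ a z y x → σ (λ e → z e - a * y e) x ≈ σ z x - a * σ y x
  σ-combine a z y x = begin
    ∑[ e < size ] ([ does (pendantAt? x e) ]· (z e - a * y e))
      ≈⟨ sum-cong-≋ (λ e → pointwise (does (pendantAt? x e)) (z e) (y e)) ⟩
    ∑[ e < size ] ([ does (pendantAt? x e) ]· z e - a * [ does (pendantAt? x e) ]· y e)
      ≈⟨ ∑-distrib-sub (λ e → [ does (pendantAt? x e) ]· z e) (λ e → a * [ does (pendantAt? x e) ]· y e) ⟩
    σ z x - ∑[ e < size ] (a * [ does (pendantAt? x e) ]· y e)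
      ≈⟨ +-congˡ (-‿cong (*-distribˡ-sum a (λ e → [ does (pendantAt? x e) ]· y e))) ⟨
    σ z x - a * σ y x ∎
    where
    pointwise : ∀ b z y → [ b ]· (z - a * y) ≈ [ b ]· z - a * [ b ]· y
    pointwise true  z y = refl
    pointwise false z y = solve 1 (λ a → con (+ 0) := con (+ 0) :- a :* con (+ 0)) refl a

-- The feedback recursion

module Fractions (ℝ : Reals) (G : Unicyclic) where
  open Rows ℝ G public

  Value : Frac → Carrier → Carrier → Carrier → Set
  Value f t a b = ⟦ num f ⟧ t ≈ a × ⟦ den f ⟧ t ≈ b

  value : ∀ f t → Value f t (⟦ num f ⟧ t) (⟦ den f ⟧ t)
  value f t = refl , refl

  value-resp : ∀ f t {a b a′ b′} → a ≈ a′ → b ≈ b′ → Value f t a b → Value f t a′ b′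
  value-resp f t a≈ b≈ (p , q) = trans p a≈ , trans q b≈

  value-const : ∀ x t → Value (const x) t x 1#
  value-const x t = ⟦const⟧ x t , ⟦const⟧ 1# t

  value-+ : ∀ f f′ t {a b a′ b′} → Value f t a b → Value f′ t a′ b′ → Value (f +ᶠ f′) t (a * b′ + a′ * b) (b * b′)
  value-+ (a / b) (a′ / b′) t (p , q) (p′ , q′) =
    trans (⟦+ₚ⟧ (a *ₚ b′) (a′ *ₚ b) t) (+-cong (trans (⟦*ₚ⟧ a b′ t) (*-cong p q′)) (trans (⟦*ₚ⟧ a′ b t) (*-cong p′ q))) ,
    trans (⟦*ₚ⟧ b b′ t) (*-cong q q′)

  value-sub : ∀ f f′ t {a b a′ b′} → Value f t a b → Value f′ t a′ b′ → Value (f -ᶠ f′) t (a * b′ - a′ * b) (b * b′)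
  value-sub (a / b) (a′ / b′) t (p , q) (p′ , q′) =
    trans (⟦-ₚ′⟧ (a *ₚ b′) (a′ *ₚ b) t) (+-cong (trans (⟦*ₚ⟧ a b′ t) (*-cong p q′)) (-‿cong (trans (⟦*ₚ⟧ a′ b t) (*-cong p′ q)))) ,
    trans (⟦*ₚ⟧ b b′ t) (*-cong q q′)

  value-* : ∀ f f′ t {a b a′ b′} → Value f t a b → Value f′ t a′ b′ → Value (f *ᶠ f′) t (a * a′) (b * b′)
  value-* (a / b) (a′ / b′) t (p , q) (p′ , q′) =
    trans (⟦*ₚ⟧ a a′ t) (*-cong p p′) , trans (⟦*ₚ⟧ b b′ t) (*-cong q q′)

  value-÷ : ∀ f f′ t {a b a′ b′} → Value f t a b → Value f′ t a′ b′ → Value (f ÷ᶠ f′) t (a * (b′ * b′)) (b * (a′ * b′))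
  value-÷ (a / b) (a′ / b′) t (p , q) (p′ , q′) =
    trans (⟦*ₚ⟧ a (b′ *ₚ b′) t) (*-cong p (trans (⟦*ₚ⟧ b′ b′ t) (*-cong q′ q′))) ,
    trans (⟦*ₚ⟧ b (a′ *ₚ b′) t) (*-cong q (trans (⟦*ₚ⟧ a′ b′ t) (*-cong p′ q′)))

  value-1 : ∀ t → Value (constℕ 1) t 1# 1#
  value-1 t = value-resp (constℕ 1) t (+-identityʳ 1#) refl (value-const _ t)

  value-feedback : ∀ f t {a b} → Value f t a b → Value (f ÷ᶠ (constℕ 1 -ᶠ f)) t (a * (b * b)) (b * ((b - a) * b))
  value-feedback f t {a} {b} vf = value-resp (f ÷ᶠ (constℕ 1 -ᶠ f)) t
    (solve 2 (λ a b → a :* (con (+ 1) :* b :* (con (+ 1) :* b)) := a :* (b :* b)) refl a b)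
    (solve 2 (λ a b → b :* ((con (+ 1) :* b :- a :* con (+ 1)) :* (con (+ 1) :* b)) := b :* ((b :- a) :* b)) refl a b)
    (value-÷ f (constℕ 1 -ᶠ f) t vf (value-sub (constℕ 1) f t (value-1 t) vf))

  -- Denominator and numerator of d_u t + 2 + d_u (1 - h) / d_s.
  Y : V → Carrier → Carrier
  Y s b = b * d s

  X : V → V → Carrier → Carrier → Carrier → Carrier
  X u s t a b = (d u * t + (1# + 1#)) * Y s b + d u * (b - a)

  value-term : ∀ u s f t {a b} → Value f t a b → Value (term u s f) t (Y s b * Y s b) (X u s t a b * Y s b)
  value-term u s f t {a} {b} vf = value-resp (term u s f) t
    (solve 2 (λ b δ → con (+ 1) :* (den′ b δ :* den′ b δ) := b :* δ :* (b :* δ)) refl b (d s))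
    (trans (*-congˡ (*-congʳ (+-congʳ (*-congʳ (+-congˡ (*-congʳ 2≈1+1))))))
      (solve 5 (λ a b δ ε t → con (+ 1) :* (num′ a b δ ε t :* den′ b δ) := ((ε :* t :+ con (+ 2)) :* (b :* δ) :+ ε :* (b :- a)) :* (b :* δ)) refl a b (d s) (d u) t))
    (value-÷ (constℕ 1) z t (value-1 t)
      (value-+ (k *ᶠ var +ᶠ constℕ 2) (k *ᶠ (constℕ 1 -ᶠ f) ÷ᶠ const (d s)) t
        (value-+ (k *ᶠ var) (constℕ 2) t
          (value-* k var t (value-const (d u) t) (⟦var⟧ t , ⟦const⟧ 1# t)) (value-const (fromℕ 2) t))
        (value-÷ (k *ᶠ (constℕ 1 -ᶠ f)) (const (d s)) t
          (value-* k (constℕ 1 -ᶠ f) t (value-const (d u) t) (value-sub (constℕ 1) f t (value-1 t) vf))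
          (value-const (d s) t))))
    where
    k z : Frac
    k = const (d u)
    z = k *ᶠ var +ᶠ constℕ 2 +ᶠ k *ᶠ (constℕ 1 -ᶠ f) ÷ᶠ const (d s)
    den′ : ∀ {n} → Polynomial n → Polynomial n → Polynomial n
    den′ b δ = con (+ 1) :* con (+ 1) :* con (+ 1) :* (con (+ 1) :* (con (+ 1) :* b) :* (δ :* con (+ 1)))
    num′ : ∀ {n} (a b δ ε t : Polynomial n) → Polynomial n
    num′ a b δ ε t =
      (ε :* t :* con (+ 1) :+ con (+ 2) :* (con (+ 1) :* con (+ 1))) :* (con (+ 1) :* (con (+ 1) :* b) :* (δ :* con (+ 1)))
      :+ ε :* (con (+ 1) :* b :- a :* con (+ 1)) :* (con (+ 1) :* con (+ 1)) :* (con (+ 1) :* con (+ 1) :* con (+ 1))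

  -- y = f(t) x with the denominator of f cleared, so that no division by zero
  -- can occur.
  Maps : Frac → Carrier → Carrier → Carrier → Set
  Maps f t x y = ⟦ den f ⟧ t * y ≈ ⟦ num f ⟧ t * x

  maps-if : ∀ {P : Set} (P? : Dec P) {f t x y} → (P → Maps f t x y) →
            Maps (if does P? then f else constℕ 0) t x ([ does P? ]· y)
  maps-if (yes p) maps = maps p
  maps-if (no _) {t = t} {x = x} _ = trans (zeroʳ _) (sym (trans (*-congʳ (⟦const⟧ 0# t)) (zeroˡ x)))

  maps-sum : ∀ {n} (f : Vector Frac n) {t x} (y : Vector Carrier n) → (∀ i → Maps (f i) t x (y i)) → Maps (sumᶠ f) t x (sum y)
  maps-sum {zero}  f {t} {x} y maps = trans (zeroʳ _) (sym (trans (*-congʳ (⟦const⟧ 0# t)) (zeroˡ x)))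
  maps-sum {suc n} f {t} {x} y maps = begin
    ⟦ den (f₀ +ᶠ fs) ⟧ t * (y₀ + ys)
      ≈⟨ *-congʳ (proj₂ val) ⟩
    b₀ * bs * (y₀ + ys)
      ≈⟨ solve 4 (λ b₀ bs y₀ ys → b₀ :* bs :* (y₀ :+ ys) := bs :* (b₀ :* y₀) :+ b₀ :* (bs :* ys)) refl b₀ bs y₀ ys ⟩
    bs * (b₀ * y₀) + b₀ * (bs * ys)
      ≈⟨ +-cong (*-congˡ (maps zero)) (*-congˡ (maps-sum (λ i → f (suc i)) (λ i → y (suc i)) (λ i → maps (suc i)))) ⟩
    bs * (a₀ * x) + b₀ * (as * x)
      ≈⟨ solve 5 (λ b₀ bs a₀ as x → bs :* (a₀ :* x) :+ b₀ :* (as :* x) := (a₀ :* bs :+ as :* b₀) :* x) refl b₀ bs a₀ as x ⟩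
    (a₀ * bs + as * b₀) * x
      ≈⟨ *-congʳ (proj₁ val) ⟨
    ⟦ num (f₀ +ᶠ fs) ⟧ t * x ∎
    where
    f₀ fs : Frac
    f₀ = f zero
    fs = sumᶠ (λ i → f (suc i))
    y₀ ys a₀ b₀ as bs : Carrier
    y₀ = y zero
    ys = ∑[ i < n ] y (suc i)
    a₀ = ⟦ num f₀ ⟧ t
    b₀ = ⟦ den f₀ ⟧ t
    as = ⟦ num fs ⟧ t
    bs = ⟦ den fs ⟧ t
    val = value-+ f₀ fs t (value f₀ t) (value fs t)

  maps-feedback : ∀ f {t x s y} → s ≈ x + y → Maps f t s y → Maps (f ÷ᶠ (constℕ 1 -ᶠ f)) t x y
  maps-feedback f {t} {x} {s} {y} s≈x+y maps = begin
    ⟦ den (f ÷ᶠ (constℕ 1 -ᶠ f)) ⟧ t * y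
      ≈⟨ *-congʳ (proj₂ val) ⟩
    b * ((b - a) * b) * y
      ≈⟨ solve 3 (λ a b y → b :* ((b :- a) :* b) :* y := b :* b :* (b :* y :- a :* y)) refl a b y ⟩
    b * b * (b * y - a * y)
      ≈⟨ *-congˡ (+-congʳ (trans maps (*-congˡ s≈x+y))) ⟩
    b * b * (a * (x + y) - a * y)
      ≈⟨ solve 4 (λ a b x y → b :* b :* (a :* (x :+ y) :- a :* y) := a :* (b :* b) :* x) refl a b x y ⟩
    a * (b * b) * x
      ≈⟨ *-congʳ (proj₁ val) ⟨
    ⟦ num (f ÷ᶠ (constℕ 1 -ᶠ f)) ⟧ t * x ∎
    where
    a b : Carrier
    a = ⟦ num f ⟧ t
    b = ⟦ den f ⟧ t
    val = value-feedback f t (value f t)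

  maps-term : ∀ z {u s e} f {t S} → Joins e u s → Row t z e u s → Star∑ z s ≈ z e + S → Maps f t (z e) S →
              Maps (term u s f) t (Star∑ z u) (z e)
  maps-term z {u} {s} {e} f {t} {S} J row Ss≈ maps = begin
    ⟦ den (term u s f) ⟧ t * z e      ≈⟨ *-congʳ (proj₂ val) ⟩
    X u s t a b * Y s b * z e         ≈⟨ solve 3 (λ x y z → x :* y :* z := y :* (x :* z)) refl (X u s t a b) (Y s b) (z e) ⟩
    Y s b * (X u s t a b * z e)       ≈⟨ *-congˡ Xz≈YS ⟩
    Y s b * (Y s b * Star∑ z u)       ≈⟨ *-assoc _ _ _ ⟨
    Y s b * Y s b * Star∑ z u         ≈⟨ *-congʳ (proj₁ val) ⟨
    ⟦ num (term u s f) ⟧ t * Star∑ z u ∎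
    where
    a b : Carrier
    a = ⟦ num f ⟧ t
    b = ⟦ den f ⟧ t
    val = value-term u s f t (value f t)

    R L p q : Carrier
    R = (t + (1# + 1#) * (r u + r s)) * z e
    L = r u * Star∑ z u + r s * (z e + S)
    p = d u * r u - 1#
    q = d s * r s - 1#

    zero-part : ∀ {x y} c → x ≈ y → c * (x - y) ≈ 0#
    zero-part c x≈y = trans (*-congˡ (x≈y⇒x∙y⁻¹≈ε x≈y)) (zeroʳ c)

    Xz≈YS : X u s t a b * z e ≈ Y s b * Star∑ z u
    Xz≈YS = begin
      X u s t a b * z e
        ≈⟨ solve 10 (λ δ ρ ε ϱ a b t z S W →
             ((δ :* t :+ con (+ 2)) :* (b :* ε) :+ δ :* (b :- a)) :* z
             := b :* ε :* W :+ (b :* δ :* ε :* ((t :+ con (+ 2) :* (ρ :+ ϱ)) :* z :- (ρ :* W :+ ϱ :* (z :+ S)))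
                :+ ((b :* ε :* (W :- con (+ 2) :* z)) :* (δ :* ρ :- con (+ 1))
                :+ ((b :* δ :* (S :- z)) :* (ε :* ϱ :- con (+ 1)) :+ δ :* (b :* S :- a :* z)))))
             refl (d u) (r u) (d s) (r s) a b t (z e) S (Star∑ z u) ⟩
      Y s b * Star∑ z u + (b * d u * d s * (R - L)
        + ((b * d s * (Star∑ z u - (1# + 1#) * z e)) * p + ((b * d u * (S - z e)) * q + d u * (b * S - a * z e))))
        ≈⟨ +-congˡ (+-cong (zero-part (b * d u * d s) (trans (sym row) (+-congˡ (*-congˡ Ss≈))))
             (+-cong (zero-part _ (dr≈1 (joins-∈ˡ J))) (+-cong (zero-part _ (dr≈1 (joins-∈ʳ J))) (zero-part (d u) maps)))) ⟩
      Y s b * Star∑ z u + (0# + (0# + (0# + 0#)))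
        ≈⟨ solve 1 (λ x → x :+ (con (+ 0) :+ (con (+ 0) :+ (con (+ 0) :+ con (+ 0)))) := x) refl (Y s b * Star∑ z u) ⟩
      Y s b * Star∑ z u ∎

  branch : ℕ → V → E → Frac
  branch n x e = term x (opposite e x) (h n e (opposite e x))

  branches : ℕ → E → V → Vector Frac size
  branches n e x e′ = if does (pendantAt? x e′ ×-dec ¬? (e ≟ e′)) then branch n x e′ else constℕ 0

  rootBranches : V → Vector Frac size
  rootBranches x e = if does (pendantAt? x e) then branch size x e else constℕ 0

  h-maps : ∀ n {j t z e u} → SolvesOn (InTree j) ricci t z → InTree j e → up-edge u ≡ e → ¬ OnCycle u →
           order ℕ.≤ dist u ℕ.+ n → Maps (h n e u) t (z e) (children∑ z e u)
  branch-maps : ∀ n {j t z e u s} → SolvesOn (InTree j) ricci t z → InTree j e → Joins e u s → up-edge s ≡ e → ¬ OnCycle s →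
           order ℕ.≤ dist s ℕ.+ n → Maps (term u s (h n e s)) t (Star∑ z u) (z e)
  branch-maps n {t = t} {z} {e} {s = s} sol T J up≡ s∉ fuel =
    maps-term z (h n e s) J (solves⇒row t z J (sol e T)) (Star∑-offCycle z s∉ (joins-∈ʳ J)) (h-maps n sol T up≡ s∉ fuel)
  h-maps zero {u = u} sol T up≡ u∉ fuel =
    contradiction (ℕₚ.≤-trans fuel (ℕₚ.≤-reflexive (ℕₚ.+-identityʳ _))) (ℕₚ.<⇒≱ (dist<order u))
  h-maps (suc n) {j} {t} {z} {e} {u} sol T up≡ u∉ fuel =
    maps-feedback (sumᶠ (branches n e u)) (Star∑-offCycle z u∉ u∈e)
      (maps-sum (branches n e u) (λ e′ → [ does (pendantAt? u e′ ×-dec ¬? (e ≟ e′)) ]· z e′) λ e′ →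
        maps-if (pendantAt? u e′ ×-dec ¬? (e ≟ e′)) {branch n u e′} (child e′))
    where
    u∈e : u ∈ₑ e
    u∈e = ≡.subst (u ∈ₑ_) up≡ (joins-∈ˡ (proj₁ (offCycle⇒parent u∉)))

    child : ∀ e′ → PendantAt u e′ × e ≢ e′ → Maps (branch n u e′) t (Star∑ z u) (z e′)
    child e′ ((pend , u∈e′) , e≢e′) with pendant-parent pend (joins-opposite u∈e′)
    ... | inj₁ (up≡′ , _) = contradiction (≡.trans (≡.sym up≡) up≡′) e≢e′
    ... | inj₂ (up≡′ , J , ds) =
      branch-maps n sol (inTree-adjacent T u∈e pend u∈e′) (joins-opposite u∈e′) up≡′ (dist≡suc⇒offCycle ds)
        (ℕₚ.≤-trans fuel (ℕₚ.≤-reflexive (≡.trans (ℕₚ.+-suc _ n) (≡.cong (ℕ._+ n) (≡.sym ds)))))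

  feedback-maps : ∀ k {t z} → SolvesOn (InTree (k mod g)) ricci t z →
                  Maps (feedback (k mod g)) t (z (c ⟨ k ⟩) + z (c ⟨ suc k ⟩)) (σ z (v ⟨ k ⟩))
  feedback-maps k {t} {z} sol =
    maps-feedback (γ (v ⟨ k ⟩)) (Star∑-v z k)
      (maps-sum (rootBranches (v ⟨ k ⟩)) (λ e → [ does (pendantAt? (v ⟨ k ⟩) e) ]· z e) λ e → maps-if (pendantAt? (v ⟨ k ⟩) e) {branch size (v ⟨ k ⟩) e} (child e))
    where
    child : ∀ e → PendantAt (v ⟨ k ⟩) e →
            Maps (branch size (v ⟨ k ⟩) e) t (Star∑ z (v ⟨ k ⟩)) (z e)
    child e (pend , v∈e) with pendant-parent pend (joins-opposite v∈e)
    ... | inj₁ (_ , _ , dv) = contradiction (_ , ≡.refl) (dist≡suc⇒offCycle dv)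
    ... | inj₂ (up≡ , J , ds) =
      branch-maps size sol (inTree-at-v pend v∈e) (joins-opposite v∈e) up≡ (dist≡suc⇒offCycle ds)
        (ℕₚ.≤-trans (ℕₚ.≤-reflexive (≡.sym |E|≡|V|)) (ℕₚ.m≤n+m size _))

-- At τ = 2 |E| each of the at most |E| terms at a vertex is at most 1 / τ.
-- Hence 0 ≤ β ≤ 1/2 and 0 ≤ h ≤ 1 throughout the recursion.
module Nonvanishing (ℝ : Reals) (G : Unicyclic) where
  open Fractions ℝ G public

  m τ : Carrier
  m = fromℕ size
  τ = m + m

  0<m : 0# < m
  0<m = 0<fromℕ (positive (c ⟨ 0 ⟩))
    where
    positive : ∀ {n} → Fin n → 0 ℕ.< n
    positive {suc n} _ = ℕ.z<s

  0≤m : 0# ≤ m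
  0≤m = proj₁ 0<m

  InUnitInterval : Frac → Set
  InUnitInterval f = 0# < ⟦ den f ⟧ τ × 0# ≤ ⟦ num f ⟧ τ × 0# ≤ ⟦ den f ⟧ τ - ⟦ num f ⟧ τ

  -- 0 ≤ f(τ) ≤ n / τ
  Bounded : Carrier → Frac → Set
  Bounded n f = 0# < ⟦ den f ⟧ τ × 0# ≤ ⟦ num f ⟧ τ × 0# ≤ n * ⟦ den f ⟧ τ - τ * ⟦ num f ⟧ τ

  1≤d : ∀ {x e} → x ∈ₑ e → 0# ≤ d x - 1#
  1≤d {x} {e} x∈e = 1≤fromℕ (filter-some (x ∈ₑ?_) (lose (∈-allFin e) x∈e))
    where
    1≤fromℕ : ∀ {n} → 0 ℕ.< n → 0# ≤ fromℕ n - 1#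
    1≤fromℕ {suc n} _ = ≤-respʳ (solve 1 (λ n → n := con (+ 1) :+ n :- con (+ 1)) refl (fromℕ n)) (0≤fromℕ n)

  bounded-term : ∀ {u s e} f → Joins e u s → InUnitInterval f → Bounded 1# (term u s f)
  bounded-term {u} {s} {e} f J (0<b , 0≤a , 0≤b-a) =
    0<-resp (sym (proj₂ val)) (0<*0< 0<X 0<Y) ,
    ≤-respʳ (sym (proj₁ val)) (proj₁ (0<*0< 0<Y 0<Y)) ,
    ≤-respʳ
      (begin
        y * ((d u - 1#) * τ * y + ((1# + 1#) * y + d u * (b - a)))
          ≈⟨ solve 5 (λ y δ τ a b → y :* ((δ :- con (+ 1)) :* τ :* y :+ (con (+ 2) :* y :+ δ :* (b :- a))) :=
                con (+ 1) :* (((δ :* τ :+ con (+ 2)) :* y :+ δ :* (b :- a)) :* y) :- τ :* (y :* y)) refl y (d u) τ a b ⟩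
        1# * (X u s τ a b * y) - τ * (y * y)
          ≈⟨ +-cong (*-congˡ (proj₂ val)) (-‿cong (*-congˡ (proj₁ val))) ⟨
        1# * ⟦ den (term u s f) ⟧ τ - τ * ⟦ num (term u s f) ⟧ τ ∎)
      (*-nonNegative (proj₁ 0<Y) (0≤+ (*-nonNegative (*-nonNegative (1≤d (joins-∈ˡ J)) 0≤τ) (proj₁ 0<Y)) (proj₁ 0<rest)))
    where
    a b y : Carrier
    a = ⟦ num f ⟧ τ
    b = ⟦ den f ⟧ τ
    y = Y s b
    val = value-term u s f τ (value f τ)

    0≤τ : 0# ≤ τ
    0≤τ = 0≤+ 0≤m 0≤m

    0<Y : 0# < y
    0<Y = 0<*0< 0<b (0<d (joins-∈ʳ J))

    0<rest : 0# < (1# + 1#) * y + d u * (b - a)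
    0<rest = 0<+0≤ (0<*0< (0<+0≤ 0<1 0≤1) 0<Y) (*-nonNegative (proj₁ (0<d (joins-∈ˡ J))) 0≤b-a)

    0<X : 0# < X u s τ a b
    0<X = 0<-resp
      (solve 5 (λ y δ τ a b → con (+ 2) :* y :+ δ :* (b :- a) :+ δ :* τ :* y := (δ :* τ :+ con (+ 2)) :* y :+ δ :* (b :- a)) refl y (d u) τ a b)
      (0<+0≤ 0<rest (*-nonNegative (*-nonNegative (proj₁ (0<d (joins-∈ˡ J))) 0≤τ) (proj₁ 0<Y)))

  inUnitInterval-0 : InUnitInterval (constℕ 0)
  inUnitInterval-0 =
    0<-resp (sym (⟦const⟧ 1# τ)) 0<1 , ≤-reflexive (sym (⟦const⟧ 0# τ)) ,
    ≤-respʳ (trans (solve 0 (con (+ 1) := con (+ 1) :- con (+ 0)) refl) (sym (+-cong (⟦const⟧ 1# τ) (-‿cong (⟦const⟧ 0# τ))))) 0≤1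

  bounded-0 : ∀ {n} → 0# ≤ n → Bounded n (const 0#)
  bounded-0 {n} 0≤n = proj₁ inUnitInterval-0 , proj₁ (proj₂ inUnitInterval-0) ,
    ≤-respʳ (trans (solve 2 (λ n τ → n := n :* con (+ 1) :- τ :* con (+ 0)) refl n τ)
      (sym (+-cong (*-congˡ (⟦const⟧ 1# τ)) (-‿cong (*-congˡ (⟦const⟧ 0# τ)))))) 0≤n

  bounded-if : ∀ {P : Set} (P? : Dec P) {f} → (P → Bounded 1# f) → Bounded 1# (if does P? then f else constℕ 0)
  bounded-if (yes p) bounded = bounded p
  bounded-if (no _)  _       = bounded-0 0≤1

  bounded-sum : ∀ {n} (f : Vector Frac n) → (∀ i → Bounded 1# (f i)) → Bounded (fromℕ n) (sumᶠ f)
  bounded-sum {zero}  f bounded = bounded-0 ≤-refl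
  bounded-sum {suc n} f bounded with bounded zero | bounded-sum (λ i → f (suc i)) (λ i → bounded (suc i))
  ... | 0<b₀ , 0≤a₀ , 0≤₀ | 0<bs , 0≤as , 0≤s =
    0<-resp (sym (proj₂ val)) (0<*0< 0<b₀ 0<bs) ,
    ≤-respʳ (sym (proj₁ val)) (0≤+ (*-nonNegative 0≤a₀ (proj₁ 0<bs)) (*-nonNegative 0≤as (proj₁ 0<b₀))) ,
    ≤-respʳ
      (begin
        bs * (1# * b₀ - τ * a₀) + b₀ * (fromℕ n * bs - τ * as)
          ≈⟨ solve 6 (λ a₀ b₀ as bs τ n → bs :* (con (+ 1) :* b₀ :- τ :* a₀) :+ b₀ :* (n :* bs :- τ :* as) :=
               (con (+ 1) :+ n) :* (b₀ :* bs) :- τ :* (a₀ :* bs :+ as :* b₀)) refl a₀ b₀ as bs τ (fromℕ n) ⟩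
        fromℕ (suc n) * (b₀ * bs) - τ * (a₀ * bs + as * b₀)
          ≈⟨ +-cong (*-congˡ (proj₂ val)) (-‿cong (*-congˡ (proj₁ val))) ⟨
        _ ∎)
      (0≤+ (*-nonNegative (proj₁ 0<bs) 0≤₀) (*-nonNegative (proj₁ 0<b₀) 0≤s))
    where
    fs : Frac
    fs = sumᶠ (λ i → f (suc i))
    a₀ b₀ as bs : Carrier
    a₀ = ⟦ num (f zero) ⟧ τ
    b₀ = ⟦ den (f zero) ⟧ τ
    as = ⟦ num fs ⟧ τ
    bs = ⟦ den fs ⟧ τ
    val = value-+ (f zero) fs τ (value (f zero) τ) (value fs τ)

  0≤-cancelˡ : ∀ {x y} → 0# < x → 0# ≤ x * y → 0# ≤ y
  0≤-cancelˡ {x} {y} 0<x 0≤xy with ≤-total 0# y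
  ... | inj₁ 0≤y = 0≤y
  ... | inj₂ y≤0 = ≤-reflexive (sym (*-zero-cancelˡ (0<⇒≉0 0<x) (≤-antisym xy≤0 0≤xy)))
    where
    xy≤0 : x * y ≤ 0#
    xy≤0 = 0≤⇒≤ (≤-respʳ (solve 2 (λ x y → x :* (con (+ 0) :- y) := con (+ 0) :- x :* y) refl x y) (*-nonNegative (proj₁ 0<x) (≤⇒0≤ y≤0)))

  inUnitInterval-feedback : ∀ f → Bounded m f → InUnitInterval (f ÷ᶠ (constℕ 1 -ᶠ f))
  inUnitInterval-feedback f (0<b , 0≤a , 0≤) =
    0<-resp (sym (proj₂ val)) (0<*0< 0<b (0<*0< 0<b-a 0<b)) ,
    ≤-respʳ (sym (proj₁ val)) (*-nonNegative 0≤a 0≤bb) ,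
    ≤-respʳ
      (begin
        b * b * (b - (1# + 1#) * a)
          ≈⟨ solve 2 (λ a b → b :* b :* (b :- con (+ 2) :* a) := b :* ((b :- a) :* b) :- a :* (b :* b)) refl a b ⟩
        b * ((b - a) * b) - a * (b * b)
          ≈⟨ +-cong (proj₂ val) (-‿cong (proj₁ val)) ⟨
        _ ∎)
      (*-nonNegative 0≤bb 0≤b-2a)
    where
    a b : Carrier
    a = ⟦ num f ⟧ τ
    b = ⟦ den f ⟧ τ
    val = value-feedback f τ (value f τ)

    0≤bb : 0# ≤ b * b
    0≤bb = proj₁ (0<*0< 0<b 0<b)

    0≤b-2a : 0# ≤ b - (1# + 1#) * a
    0≤b-2a = 0≤-cancelˡ 0<m (≤-respʳ (solve 3 (λ m a b → m :* b :- (m :+ m) :* a := m :* (b :- con (+ 2) :* a)) refl m a b) 0≤)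

    0<b-a : 0# < b - a
    0<b-a = ≤-respʳ (solve 2 (λ a b → b :- con (+ 2) :* a :+ a := b :- a) refl a b) (0≤+ 0≤b-2a 0≤a) ,
      λ 0≈b-a → 0<⇒≉0 (0<+0≤ 0<b 0≤b-2a) (begin
        b + (b - (1# + 1#) * a)     ≈⟨ solve 2 (λ a b → b :+ (b :- con (+ 2) :* a) := (b :- a) :+ (b :- a)) refl a b ⟩
        b - a + (b - a)             ≈⟨ +-cong 0≈b-a 0≈b-a ⟨
        0# + 0#                     ≈⟨ +-identityˡ 0# ⟩
        0#                          ∎)

  inUnitInterval-h : ∀ n e u → InUnitInterval (h n e u)
  inUnitInterval-h zero    e u = inUnitInterval-0
  inUnitInterval-h (suc n) e u = inUnitInterval-feedback (sumᶠ (branches n e u))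
    (bounded-sum (branches n e u) λ e′ → bounded-if (pendantAt? u e′ ×-dec ¬? (e ≟ e′)) {branch n u e′} λ ((_ , u∈e′) , _) →
      bounded-term (h n e′ (opposite e′ u)) (joins-opposite u∈e′) (inUnitInterval-h n e′ (opposite e′ u)))

  feedback-defined : ∀ j → ⟦ den (feedback j) ⟧ τ ≉ 0#
  feedback-defined j = 0<⇒≉0 (proj₁ (inUnitInterval-feedback (γ (v j))
    (bounded-sum (rootBranches (v j)) λ e → bounded-if (pendantAt? (v j) e) {branch size (v j) e} λ (_ , v∈e) →
      bounded-term (h size e (opposite e (v j))) (joins-opposite v∈e) (inUnitInterval-h size e (opposite e (v j))))))

-- Elimination of the trees

module Trees (ℝ : Reals) (G : Unicyclic) (μ : Reals.Carrier ℝ) where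
  open Nonvanishing ℝ G public
  open Elimination ℝ μ public using (PolyMatrix; SingularAt; SolvableNear; singular⊎solvable)

  module TreeSystem (j : Fin g) where

    indicatorₚ : Poly → (i k : E) → Poly
    indicatorₚ p i k = if does (i ≟ k) then p else []

    -- The identity rows make a kernel vector vanish off the tree, as in
    -- BlockEigenvalue.
    system : PolyMatrix size
    system i k = if does (inTree? j i) then indicatorₚ (num var) i k -ₚ′ [ ricci i k ] else indicatorₚ [ 1# ] i k

    ⟦indicatorₚ⟧ : ∀ p i k t w → ⟦ indicatorₚ p i k ⟧ t * w ≈ [ does (i ≟ k) ]· (⟦ p ⟧ t * w)
    ⟦indicatorₚ⟧ p i k t w with does (i ≟ k)
    ... | true  = refl
    ... | false = zeroˡ w

    row-inTree : ∀ i t (w : Vector Carrier size) → InTree j i → ∑[ k < size ] (⟦ system i k ⟧ t * w k) ≈ t * w i - (ricci · w) i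
    row-inTree i t w T = begin
      ∑[ k < size ] (⟦ system i k ⟧ t * w k)
        ≈⟨ sum-cong-≋ entry ⟩
      ∑[ k < size ] ([ does (i ≟ k) ]· (⟦ num var ⟧ t * w k) - ricci i k * w k)
        ≈⟨ ∑-distrib-sub (λ k → [ does (i ≟ k) ]· (⟦ num var ⟧ t * w k)) (λ k → ricci i k * w k) ⟩
      ∑[ k < size ] ([ does (i ≟ k) ]· (⟦ num var ⟧ t * w k)) - (ricci · w) i
        ≈⟨ +-congʳ (trans (∑-indicator i (λ k → ⟦ num var ⟧ t * w k)) (*-congʳ (⟦var⟧ t))) ⟩
      t * w i - (ricci · w) i ∎
      where
      entry : ∀ k → ⟦ system i k ⟧ t * w k ≈ [ does (i ≟ k) ]· (⟦ num var ⟧ t * w k) - ricci i k * w k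
      entry k = begin
        ⟦ system i k ⟧ t * w k
          ≡⟨ ≡.cong (λ p → ⟦ p ⟧ t * w k) (if-yes (inTree? j i) T) ⟩
        ⟦ indicatorₚ (num var) i k -ₚ′ [ ricci i k ] ⟧ t * w k
          ≈⟨ *-congʳ (trans (⟦-ₚ′⟧ (indicatorₚ (num var) i k) [ ricci i k ] t) (+-congˡ (-‿cong (⟦const⟧ _ t)))) ⟩
        (⟦ indicatorₚ (num var) i k ⟧ t - ricci i k) * w k
          ≈⟨ solve 3 (λ p q w → (p :- q) :* w := p :* w :- q :* w) refl _ (ricci i k) (w k) ⟩
        ⟦ indicatorₚ (num var) i k ⟧ t * w k - ricci i k * w k
          ≈⟨ +-congʳ (⟦indicatorₚ⟧ (num var) i k t (w k)) ⟩
        [ does (i ≟ k) ]· (⟦ num var ⟧ t * w k) - ricci i k * w k ∎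

    row-outside : ∀ i t (w : Vector Carrier size) → ¬ InTree j i → ∑[ k < size ] (⟦ system i k ⟧ t * w k) ≈ w i
    row-outside i t w ¬T = begin
      ∑[ k < size ] (⟦ system i k ⟧ t * w k)
        ≈⟨ sum-cong-≋ (λ k → trans (reflexive (≡.cong (λ p → ⟦ p ⟧ t * w k) (if-no (inTree? j i) ¬T))) (⟦indicatorₚ⟧ [ 1# ] i k t (w k))) ⟩
      ∑[ k < size ] ([ does (i ≟ k) ]· (⟦ [ 1# ] ⟧ t * w k))
        ≈⟨ ∑-indicator i (λ k → ⟦ [ 1# ] ⟧ t * w k) ⟩
      ⟦ [ 1# ] ⟧ t * w i
        ≈⟨ trans (*-congʳ (⟦const⟧ 1# t)) (*-identityˡ (w i)) ⟩
      w i ∎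

    singular⇒eigenvalue : SingularAt system → BlockEigenvalue (InTree j) ricci μ
    singular⇒eigenvalue (z , z≉0 , rows≈0) = z , z≉0 ,
      (λ i ¬T → trans (sym (row-outside i μ z ¬T)) (rows≈0 i)) ,
      (λ i T → sym (x∙y⁻¹≈ε⇒x≈y _ _ (trans (sym (row-inTree i μ z T)) (rows≈0 i))))

  -- A solution of the rows of the tree that depends rationally on the spectral
  -- parameter and is regular at μ; δ is the common denominator.
  solve-tree : ∀ {j} → AvoidsTree j μ → (y : Vector Carrier size) →
    Σ[ x ∈ Vector Poly size ] Σ[ δ ∈ Poly ] ⟦ δ ⟧ μ ≉ 0# ×
    (∀ t → (∀ e → ¬ InTree j e → ⟦ x e ⟧ t ≈ ⟦ δ ⟧ t * y e) × SolvesOn (InTree j) ricci t (λ e → ⟦ x e ⟧ t))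
  solve-tree {j} avoids y = from (singular⊎solvable system)
    where
    open TreeSystem j
    rhs : Vector Poly size
    rhs i = if does (inTree? j i) then [] else [ y i ]

    from : SingularAt system ⊎ SolvableNear system → _
    from (inj₁ sing) = contradiction (singular⇒eigenvalue sing) avoids
    from (inj₂ solv) with solv rhs
    ... | x , δ , δ≉0 , eqs = x , δ , δ≉0 , λ t →
      (λ i ¬T → begin
        ⟦ x i ⟧ t                                            ≈⟨ row-outside i t (λ k → ⟦ x k ⟧ t) ¬T ⟨
        ∑[ k < size ] (⟦ system i k ⟧ t * ⟦ x k ⟧ t)         ≈⟨ eqs t i ⟩
        ⟦ δ ⟧ t * ⟦ rhs i ⟧ t                                ≡⟨ ≡.cong (λ p → ⟦ δ ⟧ t * ⟦ p ⟧ t) (if-no (inTree? j i) ¬T) ⟩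
        ⟦ δ ⟧ t * ⟦ [ y i ] ⟧ t                              ≈⟨ *-congˡ (⟦const⟧ (y i) t) ⟩
        ⟦ δ ⟧ t * y i                                        ∎) ,
      (λ i T → sym (x∙y⁻¹≈ε⇒x≈y _ _ (begin
        t * ⟦ x i ⟧ t - (ricci · (λ k → ⟦ x k ⟧ t)) i        ≈⟨ row-inTree i t (λ k → ⟦ x k ⟧ t) T ⟨
        ∑[ k < size ] (⟦ system i k ⟧ t * ⟦ x k ⟧ t)         ≈⟨ eqs t i ⟩
        ⟦ δ ⟧ t * ⟦ rhs i ⟧ t                                ≡⟨ ≡.cong (λ p → ⟦ δ ⟧ t * ⟦ p ⟧ t) (if-yes (inTree? j i) T) ⟩
        ⟦ δ ⟧ t * 0#                                         ≈⟨ zeroʳ _ ⟩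
        0#                                                   ∎)))

  kernel-trivial : ∀ {j} → AvoidsTree j μ → ∀ z → (∀ e → ¬ InTree j e → z e ≈ 0#) →
                   SolvesOn (InTree j) ricci μ z → ∀ e → z e ≈ 0#
  kernel-trivial avoids z outside sol e with z e ≈? 0#
  ... | yes z≈0 = z≈0
  ... | no  z≉0 = contradiction (z , (e , z≉0) , outside , sol) avoids

  solves-scale : ∀ {P t} a {z} → SolvesOn P ricci t z → SolvesOn P ricci t (λ e → a * z e)
  solves-scale {t = t} a {z} sol e Pe = begin
    ∑[ k < size ] (ricci e k * (a * z k))    ≈⟨ sum-cong-≋ (λ k → solve 3 (λ m a z → m :* (a :* z) := a :* (m :* z)) refl (ricci e k) a (z k)) ⟩
    ∑[ k < size ] (a * (ricci e k * z k))    ≈⟨ *-distribˡ-sum a (λ k → ricci e k * z k) ⟨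
    a * (ricci · z) e                        ≈⟨ *-congˡ (sol e Pe) ⟩
    a * (t * z e)                            ≈⟨ solve 3 (λ a t z → a :* (t :* z) := t :* (a :* z)) refl a t (z e) ⟩
    t * (a * z e)                            ∎

  eliminates : ∀ {j} → AvoidsTree j μ → Eliminates j μ
  eliminates {j} avoids y with solve-tree avoids y
  ... | x , δ , δ≉0 , spec = z , (outside , sol) , unique
    where
    z : Vector Carrier size
    z e = ⟦ δ ⟧ μ ⁻¹ * ⟦ x e ⟧ μ

    outside : ∀ e → ¬ InTree j e → z e ≈ y e
    outside e ¬T = begin
      ⟦ δ ⟧ μ ⁻¹ * ⟦ x e ⟧ μ              ≈⟨ *-congˡ (proj₁ (spec μ) e ¬T) ⟩
      ⟦ δ ⟧ μ ⁻¹ * (⟦ δ ⟧ μ * y e)        ≈⟨ solve 3 (λ i δ y → i :* (δ :* y) := δ :* (y :* i)) refl (⟦ δ ⟧ μ ⁻¹) (⟦ δ ⟧ μ) (y e) ⟩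
      ⟦ δ ⟧ μ * (y e ÷ ⟦ δ ⟧ μ)           ≈⟨ *-÷-cancel (y e) δ≉0 ⟩
      y e                                 ∎

    sol : SolvesOn (InTree j) ricci μ z
    sol = solves-scale (⟦ δ ⟧ μ ⁻¹) (proj₂ (spec μ))

    unique : ∀ z′ → (∀ e → ¬ InTree j e → z′ e ≈ y e) × SolvesOn (InTree j) ricci μ z′ → ∀ e → z′ e ≈ z e
    unique z′ (outside′ , sol′) e = x∙y⁻¹≈ε⇒x≈y _ _ (trans (+-congˡ (-‿cong (sym (*-identityˡ (z e)))))
      (kernel-trivial avoids (λ e → z′ e - 1# * z e)
        (λ e ¬T → trans (+-cong (trans (outside′ e ¬T) (sym (outside e ¬T))) (-‿cong (*-identityˡ (z e)))) (-‿inverseʳ (z e)))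
        (solves-combine 1# sol′ sol) e))

  tree-local : ∀ k {z z′} → (∀ e → InTree (k mod g) e → z e ≈ z′ e) →
               z (c ⟨ k ⟩) + z (c ⟨ suc k ⟩) ≈ z′ (c ⟨ k ⟩) + z′ (c ⟨ suc k ⟩) →
               ∀ e → InTree (k mod g) e → (ricci · z) e ≈ (ricci · z′) e
  tree-local k {z} {z′} onTree onCycle e T = ricci-local e (onTree e T) stars
    where
    stars : ∀ x → x ∈ₑ e → Star∑ z x ≈ Star∑ z′ x
    stars x x∈e with onCycle? x
    ... | no  x∉ = Star∑-cong x λ e′ x∈e′ → onTree e′ (inTree-adjacent T x∈e (offCycle⇒pendant x∉ x∈e′) x∈e′)
    ... | yes (i , ≡.refl) with inTree-root T x∈e
    ...   | ≡.refl = begin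
      Star∑ z (v ⟨ k ⟩)                                          ≈⟨ Star∑-v z k ⟩
      z (c ⟨ k ⟩) + z (c ⟨ suc k ⟩) + σ z (v ⟨ k ⟩)              ≈⟨ +-cong onCycle (σ-cong (v ⟨ k ⟩) (λ e′ (pend , v∈) → onTree e′ (inTree-at-v pend v∈))) ⟩
      z′ (c ⟨ k ⟩) + z′ (c ⟨ suc k ⟩) + σ z′ (v ⟨ k ⟩)           ≈⟨ Star∑-v z′ k ⟨
      Star∑ z′ (v ⟨ k ⟩)                                         ∎

  cycle-not-inTree : ∀ {i j} → ¬ InTree j (c i)
  cycle-not-inTree T = proj₁ T (_ , ≡.refl)

  σ-zero : ∀ k → AvoidsTree (k mod g) μ → ∀ {w} → SolvesOn (InTree (k mod g)) ricci μ w →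
           w (c ⟨ k ⟩) + w (c ⟨ suc k ⟩) ≈ 0# → σ w (v ⟨ k ⟩) ≈ 0#
  σ-zero k avoids {w} sol boundary = trans (σ-cong x (λ e (pend , v∈e) → sym (inside e (inTree-at-v pend v∈e))))
    (trans (σ-cong {restricted} {λ _ → 0#} x (λ e _ → restricted≈0 e)) (sum-zero (λ e → []-zero (does (pendantAt? x e)))))
    where
    x = v ⟨ k ⟩
    restricted : Vector Carrier size
    restricted e = [ does (inTree? (k mod g) e) ]· w e

    []-zero : ∀ b → [ b ]· 0# ≈ 0#
    []-zero true  = refl
    []-zero false = refl

    inside : ∀ e → InTree (k mod g) e → restricted e ≈ w e
    inside e T = reflexive (if-yes (inTree? (k mod g) e) T)

    outside : ∀ e → ¬ InTree (k mod g) e → restricted e ≈ 0#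
    outside e ¬T = reflexive (if-no (inTree? (k mod g) e) ¬T)

    restricted≈0 : ∀ e → restricted e ≈ 0#
    restricted≈0 = kernel-trivial avoids restricted outside λ e T → begin
      (ricci · restricted) e    ≈⟨ tree-local k inside (trans (+-cong (outside _ cycle-not-inTree) (outside _ cycle-not-inTree)) (trans (+-identityˡ 0#) (sym boundary))) e T ⟩
      (ricci · w) e             ≈⟨ sol e T ⟩
      μ * w e                   ≈⟨ *-congˡ (inside e T) ⟨
      μ * restricted e          ∎

  module Response (k : ℕ) (avoids : AvoidsTree (k mod g) μ) where

    unit : Vector Carrier size
    unit e = [ does (c ⟨ k ⟩ ≟ e) ]· 1#

    private
      solution = solve-tree avoids unit

    x : Vector Poly size
    x = proj₁ solution

    δ : Poly
    δ = proj₁ (proj₂ solution)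

    δ≉0 : ⟦ δ ⟧ μ ≉ 0#
    δ≉0 = proj₁ (proj₂ (proj₂ solution))

    solves : ∀ t → SolvesOn (InTree (k mod g)) ricci t (λ e → ⟦ x e ⟧ t)
    solves t = proj₂ (proj₂ (proj₂ (proj₂ solution)) t)

    boundary : ∀ t → ⟦ x (c ⟨ k ⟩) ⟧ t + ⟦ x (c ⟨ suc k ⟩) ⟧ t ≈ ⟦ δ ⟧ t
    boundary t = begin
      ⟦ x (c ⟨ k ⟩) ⟧ t + ⟦ x (c ⟨ suc k ⟩) ⟧ t
        ≈⟨ +-cong (outside (c ⟨ k ⟩) cycle-not-inTree) (outside (c ⟨ suc k ⟩) cycle-not-inTree) ⟩
      ⟦ δ ⟧ t * unit (c ⟨ k ⟩) + ⟦ δ ⟧ t * unit (c ⟨ suc k ⟩)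
        ≡⟨ ≡.cong₂ (λ a b → ⟦ δ ⟧ t * a + ⟦ δ ⟧ t * b) (if-yes (c ⟨ k ⟩ ≟ c ⟨ k ⟩) ≡.refl)
             (if-no (c ⟨ k ⟩ ≟ c ⟨ suc k ⟩) λ eq → suc-mod-≢ k (≡.sym (c-injective eq))) ⟩
      ⟦ δ ⟧ t * 1# + ⟦ δ ⟧ t * 0#
        ≈⟨ solve 1 (λ d → d :* con (+ 1) :+ d :* con (+ 0) := d) refl (⟦ δ ⟧ t) ⟩
      ⟦ δ ⟧ t ∎
      where
      outside = proj₁ (proj₂ (proj₂ (proj₂ solution)) t)

    σₚ : Poly
    σₚ = sumₚ λ e → if does (pendantAt? (v ⟨ k ⟩) e) then x e else []

    ⟦σₚ⟧ : ∀ t → ⟦ σₚ ⟧ t ≈ σ (λ e → ⟦ x e ⟧ t) (v ⟨ k ⟩)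
    ⟦σₚ⟧ t = trans (⟦sumₚ⟧ (λ e → if does (pendantAt? (v ⟨ k ⟩) e) then x e else []) t)
      (sum-cong-≋ λ e → branch-eval (does (pendantAt? (v ⟨ k ⟩) e)) (x e))
      where
      branch-eval : ∀ b p → ⟦ (if b then p else []) ⟧ t ≈ [ b ]· ⟦ p ⟧ t
      branch-eval true  p = refl
      branch-eval false p = refl

    represents : ∀ t → ⟦ σₚ ⟧ t * ⟦ den (feedback (k mod g)) ⟧ t ≈ ⟦ num (feedback (k mod g)) ⟧ t * ⟦ δ ⟧ t
    represents t = begin
      ⟦ σₚ ⟧ t * ⟦ den f ⟧ t                              ≈⟨ *-comm _ _ ⟩
      ⟦ den f ⟧ t * ⟦ σₚ ⟧ t                              ≈⟨ *-congˡ (⟦σₚ⟧ t) ⟩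
      ⟦ den f ⟧ t * σ (λ e → ⟦ x e ⟧ t) (v ⟨ k ⟩)         ≈⟨ feedback-maps k (solves t) ⟩
      ⟦ num f ⟧ t * (⟦ x (c ⟨ k ⟩) ⟧ t + ⟦ x (c ⟨ suc k ⟩) ⟧ t)    ≈⟨ *-congˡ (boundary t) ⟩
      ⟦ num f ⟧ t * ⟦ δ ⟧ t                               ∎
      where
      f : Frac
      f = feedback (k mod g)

    feedback-regular : ∃[ ψ ] feedback (k mod g) HasValue ψ At μ
    feedback-regular = ⟦ σₚ ⟧ μ ÷ ⟦ δ ⟧ μ , record
      { defined    = τ , feedback-defined (k mod g)
      ; rep        = σₚ / δ
      ; represents = represents
      ; regular    = δ≉0
      ; value      = refl
      }

    feedback-σ : ∀ ψ → feedback (k mod g) HasValue ψ At μ → ∀ z → SolvesOn (InTree (k mod g)) ricci μ z →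
                 σ z (v ⟨ k ⟩) ≈ ψ * (z (c ⟨ k ⟩) + z (c ⟨ suc k ⟩))
    feedback-σ ψ hasValue z sol = *-cancelˡ (*-≉0 δ≉0 regular) (begin
      D * q * σ z (v ⟨ k ⟩)      ≈⟨ *-congˡ σz≈aσx ⟩
      D * q * (a * s)            ≈⟨ solve 4 (λ D q a s → D :* q :* (a :* s) := s :* q :* (D :* a)) refl D q a s ⟩
      s * q * (D * a)            ≈⟨ *-congˡ (*-÷-cancel Z δ≉0) ⟩
      s * q * Z                  ≈⟨ *-congʳ (cross-multiply (num f) (den f) (num rep) (den rep) σₚ δ (proj₂ defined) rep≈ represents μ) ⟨
      p * D * Z                  ≈⟨ *-congʳ (*-congʳ (trans (*-congˡ value′) (*-÷-cancel p regular))) ⟨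
      q * ψ * D * Z              ≈⟨ solve 4 (λ q ψ D Z → q :* ψ :* D :* Z := D :* q :* (ψ :* Z)) refl q ψ D Z ⟩
      D * q * (ψ * Z)            ∎)
      where
      open _HasValue_At_ hasValue using (defined; rep; regular) renaming (represents to rep≈; value to value′)
      f : Frac
      f = feedback (k mod g)
      p q D s Z a : Carrier
      p = ⟦ num rep ⟧ μ
      q = ⟦ den rep ⟧ μ
      D = ⟦ δ ⟧ μ
      s = ⟦ σₚ ⟧ μ
      Z = z (c ⟨ k ⟩) + z (c ⟨ suc k ⟩)
      a = Z ÷ D
      xμ : Vector Carrier size
      xμ e = ⟦ x e ⟧ μ

      σz≈aσx : σ z (v ⟨ k ⟩) ≈ a * s
      σz≈aσx = x∙y⁻¹≈ε⇒x≈y _ _ (begin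
        σ z (v ⟨ k ⟩) - a * s                       ≈⟨ +-congˡ (-‿cong (*-congˡ (⟦σₚ⟧ μ))) ⟩
        σ z (v ⟨ k ⟩) - a * σ xμ (v ⟨ k ⟩)          ≈⟨ σ-combine a z xμ (v ⟨ k ⟩) ⟨
        σ (λ e → z e - a * xμ e) (v ⟨ k ⟩)          ≈⟨ σ-zero k avoids (solves-combine a sol (solves μ)) (begin
          z (c ⟨ k ⟩) - a * xμ (c ⟨ k ⟩) + (z (c ⟨ suc k ⟩) - a * xμ (c ⟨ suc k ⟩))
            ≈⟨ solve 5 (λ z x z′ x′ a → z :- a :* x :+ (z′ :- a :* x′) := z :+ z′ :- a :* (x :+ x′)) refl (z (c ⟨ k ⟩)) (xμ (c ⟨ k ⟩)) (z (c ⟨ suc k ⟩)) (xμ (c ⟨ suc k ⟩)) a ⟩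
          Z - a * (xμ (c ⟨ k ⟩) + xμ (c ⟨ suc k ⟩))
            ≈⟨ +-congˡ (-‿cong (trans (*-congˡ (boundary μ)) (trans (*-comm a D) (*-÷-cancel Z δ≉0)))) ⟩
          Z - Z
            ≈⟨ -‿inverseʳ Z ⟩
          0# ∎) ⟩
        0#                                          ∎)

-- The problem along the cycle

module CycleProblem (ℝ : Reals) (G : Unicyclic) (μ : Reals.Carrier ℝ) where
  open Trees ℝ G μ public

  module Reduction (avoids : ∀ j → AvoidsTree j μ) (Ψ : Fin g → Carrier) (values : ∀ j → feedback j HasValue Ψ j At μ) where
    open Cycle μ Ψ public

    ≈-transport : ∀ {a b x y} → a - b ≈ x - y → a ≈ b → x ≈ y
    ≈-transport {a} {b} {x} {y} eq a≈b = x∙y⁻¹≈ε⇒x≈y x y (trans (sym eq) (x≈y⇒x∙y⁻¹≈ε a≈b))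

    Star∑-Ψ : ∀ k z → SolvesOn (InTree (k mod g)) ricci μ z →
              Star∑ z (v ⟨ k ⟩) ≈ (1# + Ψ ⟨ k ⟩) * (z (c ⟨ k ⟩) + z (c ⟨ suc k ⟩))
    Star∑-Ψ k z sol = begin
      Star∑ z (v ⟨ k ⟩)                    ≈⟨ Star∑-v z k ⟩
      Z + σ z (v ⟨ k ⟩)                    ≈⟨ +-congˡ (Response.feedback-σ k (avoids (k mod g)) (Ψ ⟨ k ⟩) (values (k mod g)) z sol) ⟩
      Z + Ψ ⟨ k ⟩ * Z                      ≈⟨ solve 2 (λ z ψ → z :+ ψ :* z := (con (+ 1) :+ ψ) :* z) refl Z (Ψ ⟨ k ⟩) ⟩
      (1# + Ψ ⟨ k ⟩) * Z                   ∎
      where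
      Z : Carrier
      Z = z (c ⟨ k ⟩) + z (c ⟨ suc k ⟩)

    Step : ℕ → (y₀ y₁ y₂ : Carrier) → Set
    Step k y₀ y₁ y₂ = P (suc k) * y₂ ≈ Q₊ k * y₁ - P k * y₀

    ReducedRow : ℕ → (y₀ y₁ y₂ : Carrier) → Set
    ReducedRow k y₀ y₁ y₂ =
      r (v ⟨ k ⟩) * ((1# + Ψ ⟨ k ⟩) * (y₀ + y₁)) + r (v ⟨ suc k ⟩) * ((1# + Ψ ⟨ suc k ⟩) * (y₁ + y₂))
        ≈ (μ + (1# + 1#) * (r (v ⟨ k ⟩) + r (v ⟨ suc k ⟩))) * y₁

    step-row : ∀ k y₀ y₁ y₂ →
      r (v ⟨ k ⟩) * ((1# + Ψ ⟨ k ⟩) * (y₀ + y₁)) + r (v ⟨ suc k ⟩) * ((1# + Ψ ⟨ suc k ⟩) * (y₁ + y₂))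
        - (μ + (1# + 1#) * (r (v ⟨ k ⟩) + r (v ⟨ suc k ⟩))) * y₁
      ≈ P (suc k) * y₂ - (Q₊ k * y₁ - P k * y₀)
    step-row k y₀ y₁ y₂ = solve 8 (λ ι κ ψ φ μ y₀ y₁ y₂ →
      con (+ 1) :* ι :* ((con (+ 1) :+ ψ) :* (y₀ :+ y₁)) :+ con (+ 1) :* κ :* ((con (+ 1) :+ φ) :* (y₁ :+ y₂))
        :- (μ :+ con (+ 2) :* (con (+ 1) :* ι :+ con (+ 1) :* κ)) :* y₁
      := (con (+ 1) :+ φ) :* κ :* y₂
        :- ((μ :+ (con (+ 1) :- ψ) :* ι :+ (con (+ 1) :- φ) :* κ) :* y₁ :- (con (+ 1) :+ ψ) :* ι :* y₀))
      refl (d (v ⟨ k ⟩) ⁻¹) (d (v ⟨ suc k ⟩) ⁻¹) (Ψ ⟨ k ⟩) (Ψ ⟨ suc k ⟩) μ y₀ y₁ y₂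

    row⇒step : ∀ k {y₀ y₁ y₂} → ReducedRow k y₀ y₁ y₂ → Step k y₀ y₁ y₂
    row⇒step k {y₀} {y₁} {y₂} = ≈-transport (step-row k y₀ y₁ y₂)

    step⇒row : ∀ k {y₀ y₁ y₂} → Step k y₀ y₁ y₂ → ReducedRow k y₀ y₁ y₂
    step⇒row k {y₀} {y₁} {y₂} = ≈-transport (sym (step-row k y₀ y₁ y₂))

    step-cong : ∀ k {y₀ y₁ y₂ y₀′ y₁′ y₂′} → y₀ ≈ y₀′ → y₁ ≈ y₁′ → y₂ ≈ y₂′ → Step k y₀ y₁ y₂ → Step k y₀′ y₁′ y₂′
    step-cong k e₀ e₁ e₂ step =
      trans (*-congˡ (sym e₂)) (trans step (+-cong (*-congˡ e₁) (-‿cong (*-congˡ e₀))))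

    solution⇒periodic : ∀ y → (Σ[ z ∈ Vector Carrier size ] Solves ricci μ z × (∀ j → z (c j) ≈ y j)) → Periodic y
    solution⇒periodic y (z , sol , z≈y) k = step-cong k (z≈y _) (z≈y _) (z≈y _) (row⇒step k (begin
      _ ≈⟨ +-cong (*-congˡ (Star∑-Ψ k z (λ e _ → sol e _))) (*-congˡ (Star∑-Ψ (suc k) z (λ e _ → sol e _))) ⟨
      r (v ⟨ k ⟩) * Star∑ z (v ⟨ k ⟩) + r (v ⟨ suc k ⟩) * Star∑ z (v ⟨ suc k ⟩)
        ≈⟨ solves⇒row μ z (c-joins k) (sol (c ⟨ suc k ⟩) _) ⟩
      _ ∎))

    module Glue (y : Fin g → Carrier) (periodic : Periodic y) where

      prescribed : Vector Carrier size
      prescribed e with any? (λ j → c j ≟ e)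
      ... | yes (j , _) = y j
      ... | no  _       = 0#

      prescribed-c : ∀ j → prescribed (c j) ≈ y j
      prescribed-c j with any? (λ i → c i ≟ c j)
      ... | yes (i , ci≡cj) = reflexive (≡.cong y (c-injective ci≡cj))
      ... | no  none        = contradiction (j , ≡.refl) none

      branch-solution : Fin g → Vector Carrier size
      branch-solution j = proj₁ (eliminates (avoids j) prescribed)

      branch-c : ∀ j i → branch-solution j (c i) ≈ y i
      branch-c j i = trans (proj₁ (proj₁ (proj₂ (eliminates (avoids j) prescribed))) (c i) cycle-not-inTree) (prescribed-c i)

      branch-solves : ∀ j → SolvesOn (InTree j) ricci μ (branch-solution j)
      branch-solves j = proj₂ (proj₁ (proj₂ (eliminates (avoids j) prescribed)))

      glue : ∀ e → Dec (Pendant e) → Carrier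
      glue e (yes pend) = branch-solution (proj₁ (pendant⇒inTree pend)) e
      glue e (no  _)    = prescribed e

      glued : Vector Carrier size
      glued e = glue e (pendant? e)

      glued-c : ∀ j → glued (c j) ≈ y j
      glued-c j = on-cycle (pendant? (c j))
        where
        on-cycle : ∀ P? → glue (c j) P? ≈ y j
        on-cycle (yes pend) = contradiction (j , ≡.refl) pend
        on-cycle (no  _)    = prescribed-c j

      glued-inTree : ∀ j e → InTree j e → glued e ≈ branch-solution j e
      glued-inTree j e T = on-tree (pendant? e)
        where
        on-tree : ∀ P? → glue e P? ≈ branch-solution j e
        on-tree (no ¬pend) = contradiction (proj₁ T) ¬pend
        on-tree (yes pend) = reflexive (≡.cong (λ i → branch-solution i e) (inTree-unique (proj₂ (pendant⇒inTree pend)) T))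

      glued-solves-tree : ∀ k → SolvesOn (InTree (k mod g)) ricci μ glued
      glued-solves-tree k e T = begin
        (ricci · glued) e              ≈⟨ tree-local k (glued-inTree j) (+-cong (agree _) (agree _)) e T ⟩
        (ricci · branch-solution j) e  ≈⟨ branch-solves j e T ⟩
        μ * branch-solution j e        ≈⟨ *-congˡ (glued-inTree j e T) ⟨
        μ * glued e                    ∎
        where
        j : Fin g
        j = k mod g
        agree : ∀ i → glued (c i) ≈ branch-solution j (c i)
        agree i = trans (glued-c i) (sym (branch-c j i))

      glued-solves-cycle : ∀ k → (ricci · glued) (c ⟨ suc k ⟩) ≈ μ * glued (c ⟨ suc k ⟩)
      glued-solves-cycle k = row⇒solves μ glued (c-joins k) (begin
        r (v ⟨ k ⟩) * Star∑ glued (v ⟨ k ⟩) + r (v ⟨ suc k ⟩) * Star∑ glued (v ⟨ suc k ⟩)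
          ≈⟨ +-cong (*-congˡ (Star∑-Ψ k glued (glued-solves-tree k))) (*-congˡ (Star∑-Ψ (suc k) glued (glued-solves-tree (suc k)))) ⟩
        _ ≈⟨ step⇒row k (step-cong k (sym (glued-c _)) (sym (glued-c _)) (sym (glued-c _)) (periodic k)) ⟩
        _ ∎)

      glued-solves : Solves ricci μ glued
      glued-solves e _ = by-kind (any? (λ j → c j ≟ e))
        where
        by-kind : Dec (∃[ j ] c j ≡ e) → (ricci · glued) e ≈ μ * glued e
        by-kind (no pend) = glued-solves-tree (toℕ j) e (≡.subst (λ i → InTree i e) (≡.sym (toℕ-mod-inverse j)) (proj₂ (pendant⇒inTree pend)))
          where
          j : Fin g
          j = proj₁ (pendant⇒inTree pend)
        by-kind (yes (j , cj≡e)) =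
          ≡.subst (λ e → (ricci · glued) e ≈ μ * glued e) (≡.trans (≡.cong c (proj₂ (pred-mod j))) cj≡e)
            (glued-solves-cycle (proj₁ (pred-mod j)))

    periodic⇒solution : ∀ y → Periodic y → Σ[ z ∈ Vector Carrier size ] Solves ricci μ z × (∀ j → z (c j) ≈ y j)
    periodic⇒solution y periodic = glued , glued-solves , glued-c
      where open Glue y periodic

    +g-mod : ∀ k → (k ℕ.+ g) mod g ≡ k mod g
    +g-mod k = %⇒mod ([m+n]%n≡m%n k g)

    P-mod : ∀ {k l} → k mod g ≡ l mod g → P k ≡ P l
    P-mod eq = ≡.cong (λ j → (1# + Ψ j) ÷ d (v j)) eq

    Q₊-mod : ∀ {k l} → k mod g ≡ l mod g → Q₊ k ≡ Q₊ l
    Q₊-mod {k} {l} eq = ≡.cong₂ (λ i j → μ + (1# - Ψ i) ÷ d (v i) + (1# - Ψ j) ÷ d (v j)) eq (suc-mod-cong {k} {l} eq)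

    module Transfer (P≉0 : ∀ k → P k ≉ 0#) where

      Recurrence : (ℕ → Carrier) → Set
      Recurrence s = ∀ k → Step k (s k) (s (suc k)) (s (suc (suc k)))

      M : ℕ → Fin 2 → Fin 2 → Carrier
      M = transfer

      solve-step : ∀ k {y₀ y₁ y₂} → Step k y₀ y₁ y₂ → y₂ ≈ Q₊ k ÷ P (suc k) * y₁ - P k ÷ P (suc k) * y₀
      solve-step k {y₀} {y₁} {y₂} step = *-cancelˡ (P≉0 (suc k)) (begin
        P (suc k) * y₂
          ≈⟨ step ⟩
        Q₊ k * y₁ - P k * y₀
          ≈⟨ +-cong (*-congʳ (*-÷-cancel (Q₊ k) (P≉0 (suc k)))) (-‿cong (*-congʳ (*-÷-cancel (P k) (P≉0 (suc k))))) ⟨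
        P (suc k) * (Q₊ k ÷ P (suc k)) * y₁ - P (suc k) * (P k ÷ P (suc k)) * y₀
          ≈⟨ solve 5 (λ p q p′ y₁ y₀ → p :* q :* y₁ :- p :* p′ :* y₀ := p :* (q :* y₁ :- p′ :* y₀)) refl
               (P (suc k)) (Q₊ k ÷ P (suc k)) (P k ÷ P (suc k)) y₁ y₀ ⟩
        P (suc k) * (Q₊ k ÷ P (suc k) * y₁ - P k ÷ P (suc k) * y₀) ∎)

      transfer-states : ∀ {s} → Recurrence s → ∀ n →
        s (suc n) ≈ M n 0F 0F * s 1 + M n 0F 1F * s 0 ×
        s n ≈ M n 1F 0F * s 1 + M n 1F 1F * s 0
      transfer-states {s} rec zero =
        solve 2 (λ x y → x := con (+ 1) :* x :+ con (+ 0) :* y) refl (s 1) (s 0) ,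
        solve 2 (λ x y → y := con (+ 0) :* x :+ con (+ 1) :* y) refl (s 1) (s 0)
      transfer-states {s} rec (suc n) with transfer-states rec n
      ... | s₁≈ , s₀≈ =
        (begin
          s (suc (suc n))
            ≈⟨ solve-step n (rec n) ⟩
          q * s (suc n) - p * s n
            ≈⟨ +-cong (*-congˡ s₁≈) (-‿cong (*-congˡ s₀≈)) ⟩
          q * (M n 0F 0F * s 1 + M n 0F 1F * s 0) - p * (M n 1F 0F * s 1 + M n 1F 1F * s 0)
            ≈⟨ solve 8 (λ q p a b c e x y → q :* (a :* x :+ b :* y) :- p :* (c :* x :+ e :* y) :=
                 (q :* a :+ ((:- p) :* c :+ con (+ 0))) :* x :+ (q :* b :+ ((:- p) :* e :+ con (+ 0))) :* y) refl
                 q p (M n 0F 0F) (M n 0F 1F) (M n 1F 0F) (M n 1F 1F) (s 1) (s 0) ⟩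
          M (suc n) 0F 0F * s 1 + M (suc n) 0F 1F * s 0 ∎) ,
        (begin
          s (suc n)
            ≈⟨ s₁≈ ⟩
          M n 0F 0F * s 1 + M n 0F 1F * s 0
            ≈⟨ solve 6 (λ a b c e x y → a :* x :+ b :* y :=
                 (con (+ 1) :* a :+ (con (+ 0) :* c :+ con (+ 0))) :* x :+ (con (+ 1) :* b :+ (con (+ 0) :* e :+ con (+ 0))) :* y) refl
                 (M n 0F 0F) (M n 0F 1F) (M n 1F 0F) (M n 1F 1F) (s 1) (s 0) ⟩
          M (suc n) 1F 0F * s 1 + M (suc n) 1F 1F * s 0 ∎)
        where
        q p : Carrier
        q = Q₊ n ÷ P (suc n)
        p = P n ÷ P (suc n)

      det : ℕ → Carrier
      det n = M n 0F 0F * M n 1F 1F - M n 0F 1F * M n 1F 0F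

      P*det : ∀ n → P n * det n ≈ P 0
      P*det zero = solve 1 (λ p → p :* (con (+ 1) :* con (+ 1) :- con (+ 0) :* con (+ 0)) := p) refl (P 0)
      P*det (suc n) = begin
        P (suc n) * det (suc n)
          ≈⟨ *-congˡ (solve 6 (λ q p a b c e →
               (q :* a :+ ((:- p) :* c :+ con (+ 0))) :* (con (+ 1) :* b :+ (con (+ 0) :* e :+ con (+ 0)))
               :- (q :* b :+ ((:- p) :* e :+ con (+ 0))) :* (con (+ 1) :* a :+ (con (+ 0) :* c :+ con (+ 0)))
               := p :* (a :* e :- b :* c)) refl q p (M n 0F 0F) (M n 0F 1F) (M n 1F 0F) (M n 1F 1F)) ⟩
        P (suc n) * (p * det n)
          ≈⟨ *-assoc _ _ _ ⟨
        P (suc n) * p * det n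
          ≈⟨ *-congʳ (*-÷-cancel (P n) (P≉0 (suc n))) ⟩
        P n * det n
          ≈⟨ P*det n ⟩
        P 0 ∎
        where
        q p : Carrier
        q = Q₊ n ÷ P (suc n)
        p = P n ÷ P (suc n)

      det-g : det g ≈ 1#
      det-g = *-cancelˡ (P≉0 g) (begin
        P g * det g    ≈⟨ P*det g ⟩
        P 0            ≡⟨ P-mod (+g-mod 0) ⟨
        P g            ≈⟨ *-identityʳ (P g) ⟨
        P g * 1#       ∎)

      a b c′ e : Carrier
      a  = M g 0F 0F
      b  = M g 0F 1F
      c′ = M g 1F 0F
      e  = M g 1F 1F

      -- det (M - 1) = 2 - tr M, because det M = 1.
      characteristic : (a - 1#) * (e - 1#) - b * c′ ≈ fromℕ 2 - trace (transfer g)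
      characteristic = begin
        (a - 1#) * (e - 1#) - b * c′
          ≈⟨ solve 4 (λ a b c e → (a :- con (+ 1)) :* (e :- con (+ 1)) :- b :* c := con (+ 1) :+ (a :* e :- b :* c) :- (a :+ (e :+ con (+ 0)))) refl a b c′ e ⟩
        1# + det g - trace (transfer g)
          ≈⟨ +-congʳ (trans (+-congˡ det-g) (sym 2≈1+1)) ⟩
        fromℕ 2 - trace (transfer g) ∎

      fixed⇒trace : ∀ {x₁ x₀} → ¬ (x₁ ≈ 0# × x₀ ≈ 0#) → x₁ ≈ a * x₁ + b * x₀ → x₀ ≈ c′ * x₁ + e * x₀ →
                    trace (transfer g) ≈ fromℕ 2
      fixed⇒trace {x₁} {x₀} x≉0 fix₁ fix₀ = decide (Δ ≈? 0#)
        where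
        Δ u₁ u₀ : Carrier
        Δ = (a - 1#) * (e - 1#) - b * c′
        u₁ = a * x₁ + b * x₀ - x₁
        u₀ = c′ * x₁ + e * x₀ - x₀

        u₁≈0 : u₁ ≈ 0#
        u₁≈0 = x≈y⇒x∙y⁻¹≈ε (sym fix₁)
        u₀≈0 : u₀ ≈ 0#
        u₀≈0 = x≈y⇒x∙y⁻¹≈ε (sym fix₀)

        vanish : ∀ p q → p * u₁ - q * u₀ ≈ 0#
        vanish p q = trans (+-cong (trans (*-congˡ u₁≈0) (zeroʳ p)) (-‿cong (trans (*-congˡ u₀≈0) (zeroʳ q)))) (-‿inverseʳ 0#)

        Δx₁≈0 : Δ * x₁ ≈ 0#
        Δx₁≈0 = trans (solve 6 (λ a b c e x₁ x₀ → ((a :- con (+ 1)) :* (e :- con (+ 1)) :- b :* c) :* x₁ :=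
          (e :- con (+ 1)) :* (a :* x₁ :+ b :* x₀ :- x₁) :- b :* (c :* x₁ :+ e :* x₀ :- x₀)) refl a b c′ e x₁ x₀) (vanish (e - 1#) b)

        Δx₀≈0 : Δ * x₀ ≈ 0#
        Δx₀≈0 = trans (solve 6 (λ a b c e x₁ x₀ → ((a :- con (+ 1)) :* (e :- con (+ 1)) :- b :* c) :* x₀ :=
          (:- c) :* (a :* x₁ :+ b :* x₀ :- x₁) :- (:- (a :- con (+ 1))) :* (c :* x₁ :+ e :* x₀ :- x₀)) refl a b c′ e x₁ x₀) (vanish (- c′) (- (a - 1#)))

        decide : Dec (Δ ≈ 0#) → trace (transfer g) ≈ fromℕ 2
        decide (yes Δ≈0) = sym (x∙y⁻¹≈ε⇒x≈y _ _ (trans (sym characteristic) Δ≈0))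
        decide (no  Δ≉0) = contradiction (*-zero-cancelˡ Δ≉0 Δx₁≈0 , *-zero-cancelˡ Δ≉0 Δx₀≈0) x≉0

      FixedVector : Set
      FixedVector = ∃[ x₁ ] ∃[ x₀ ] (x₁ ≉ 0# ⊎ x₀ ≉ 0#) × x₁ ≈ a * x₁ + b * x₀ × x₀ ≈ c′ * x₁ + e * x₀

      trace⇒fixed : trace (transfer g) ≈ fromℕ 2 → FixedVector
      trace⇒fixed tr≈2 = choose (b ≈? 0#) (a ≈? 1#)
        where
        Δ≈0 : (a - 1#) * (e - 1#) - b * c′ ≈ 0#
        Δ≈0 = trans characteristic (x≈y⇒x∙y⁻¹≈ε (sym tr≈2))

        a-1≉0 : a ≉ 1# → 1# - a ≉ 0#
        a-1≉0 a≉1 eq = a≉1 (sym (x∙y⁻¹≈ε⇒x≈y 1# a eq))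

        second : c′ * b + e * (1# - a) ≈ 1# - a
        second = ≈-transport
          (solve 4 (λ a b c e → con (+ 0) :- ((a :- con (+ 1)) :* (e :- con (+ 1)) :- b :* c) := c :* b :+ e :* (con (+ 1) :- a) :- (con (+ 1) :- a)) refl a b c′ e)
          (sym Δ≈0)

        -- (b , 1 - a) spans the kernel of M - 1 unless it vanishes.
        generic : b ≉ 0# ⊎ 1# - a ≉ 0# → FixedVector
        generic nonzero = b , 1# - a , nonzero ,
          solve 2 (λ a b → b := a :* b :+ b :* (con (+ 1) :- a)) refl a b , sym second

        choose : Dec (b ≈ 0#) → Dec (a ≈ 1#) → FixedVector
        choose (no b≉0)  _         = generic (inj₁ b≉0)
        choose (yes _)   (no a≉1)  = generic (inj₂ (a-1≉0 a≉1))
        choose (yes b≈0) (yes a≈1) = 0# , 1# , inj₂ 1≉0 ,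
          sym (trans (+-cong (zeroʳ a) (trans (*-congʳ b≈0) (zeroˡ 1#))) (+-identityˡ 0#)) ,
          sym (trans (+-cong (zeroʳ c′) (*-identityʳ e)) (trans (+-identityˡ e) e≈1))
          where
          e≈1 : e ≈ 1#
          e≈1 = begin
            e                           ≈⟨ solve 2 (λ e c → e := con (+ 1) :* e :- con (+ 0) :* c) refl e c′ ⟩
            1# * e - 0# * c′            ≈⟨ +-cong (*-congʳ a≈1) (-‿cong (*-congʳ b≈0)) ⟨
            det g                       ≈⟨ det-g ⟩
            1#                          ∎

      recurrence-zero : ∀ {s} → Recurrence s → s 1 ≈ 0# → s 0 ≈ 0# → ∀ n → s (suc n) ≈ 0# × s n ≈ 0#
      recurrence-zero rec s₁≈0 s₀≈0 zero = s₁≈0 , s₀≈0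
      recurrence-zero rec s₁≈0 s₀≈0 (suc n) with recurrence-zero rec s₁≈0 s₀≈0 n
      ... | sₙ₊₁≈0 , sₙ≈0 = trans (solve-step n (rec n)) (trans (+-cong (trans (*-congˡ sₙ₊₁≈0) (zeroʳ _)) (-‿cong (trans (*-congˡ sₙ≈0) (zeroʳ _)))) (-‿inverseʳ 0#)) , sₙ₊₁≈0

      periodic⇒trace : ∀ y → Periodic y → (∃[ j ] y j ≉ 0#) → trace (transfer g) ≈ fromℕ 2
      periodic⇒trace y periodic (j , yj≉0) with transfer-states {λ k → y ⟨ k ⟩} periodic g
      ... | fix₁ , fix₀ = fixed⇒trace
        (λ (y₁≈0 , y₀≈0) → yj≉0 (trans (reflexive (≡.cong y (≡.sym (toℕ-mod-inverse j))))
          (proj₂ (recurrence-zero {λ k → y ⟨ k ⟩} periodic y₁≈0 y₀≈0 (toℕ j)))))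
        (trans (reflexive (≡.cong y (≡.sym (+g-mod 1)))) fix₁)
        (trans (reflexive (≡.cong y (≡.sym (+g-mod 0)))) fix₀)

      module Unfold (x₁ x₀ : Carrier) where

        -- (s (k + 1) , s k)
        state : ℕ → Carrier × Carrier
        state zero    = x₁ , x₀
        state (suc k) with state k
        ... | s₁ , s₀ = (Q₊ k * s₁ - P k * s₀) ÷ P (suc k) , s₁

        s : ℕ → Carrier
        s k = proj₂ (state k)

        recurrence : Recurrence s
        recurrence k = *-÷-cancel (Q₊ k * proj₁ (state k) - P k * proj₂ (state k)) (P≉0 (suc k))

        module _ (fix₁ : x₁ ≈ a * x₁ + b * x₀) (fix₀ : x₀ ≈ c′ * x₁ + e * x₀) where

          s+g : ∀ k → s (suc k ℕ.+ g) ≈ s (suc k) × s (k ℕ.+ g) ≈ s k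
          s+g zero = trans (proj₁ (transfer-states {s} recurrence g)) (sym fix₁) ,
                     trans (proj₂ (transfer-states {s} recurrence g)) (sym fix₀)
          s+g (suc k) with s+g k
          ... | eq₁ , eq₀ = *-cancelˡ (P≉0 (suc k)) (begin
              P (suc k) * s (suc (suc k) ℕ.+ g)
                ≡⟨ ≡.cong (_* s (suc (suc k) ℕ.+ g)) (P-mod (+g-mod (suc k))) ⟨
              P (suc k ℕ.+ g) * s (suc (suc k) ℕ.+ g)
                ≈⟨ recurrence (k ℕ.+ g) ⟩
              Q₊ (k ℕ.+ g) * s (suc k ℕ.+ g) - P (k ℕ.+ g) * s (k ℕ.+ g)
                ≈⟨ +-cong (*-cong (reflexive (Q₊-mod {k ℕ.+ g} {k} (+g-mod k))) eq₁) (-‿cong (*-cong (reflexive (P-mod (+g-mod k))) eq₀)) ⟩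
              Q₊ k * s (suc k) - P k * s k
                ≈⟨ recurrence k ⟨
              P (suc k) * s (suc (suc k)) ∎) , eq₁

          s+mg : ∀ m k → s (k ℕ.+ m ℕ.* g) ≈ s k
          s+mg zero    k = reflexive (≡.cong s (ℕₚ.+-identityʳ k))
          s+mg (suc m) k = begin
            s (k ℕ.+ (g ℕ.+ m ℕ.* g))    ≡⟨ ≡.cong s (≡.trans (≡.cong (k ℕ.+_) (ℕₚ.+-comm g (m ℕ.* g))) (≡.sym (ℕₚ.+-assoc k (m ℕ.* g) g))) ⟩
            s (k ℕ.+ m ℕ.* g ℕ.+ g)      ≈⟨ proj₂ (s+g (k ℕ.+ m ℕ.* g)) ⟩
            s (k ℕ.+ m ℕ.* g)            ≈⟨ s+mg m k ⟩
            s k                          ∎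

          y : Fin g → Carrier
          y j = s (toℕ j)

          y⟨⟩ : ∀ k → y ⟨ k ⟩ ≈ s k
          y⟨⟩ k = begin
            s (toℕ (k mod g))                ≡⟨ ≡.cong s (toℕ-mod k) ⟩
            s (k % g)                        ≈⟨ s+mg (k ℕ./ g) (k % g) ⟨
            s (k % g ℕ.+ (k ℕ./ g) ℕ.* g)      ≡⟨ ≡.cong s (m≡m%n+[m/n]*n k g) ⟨
            s k                              ∎

          y-periodic : Periodic y
          y-periodic k = step-cong k (sym (y⟨⟩ k)) (sym (y⟨⟩ (suc k))) (sym (y⟨⟩ (suc (suc k)))) (recurrence k)

          y-nonzero : x₁ ≉ 0# ⊎ x₀ ≉ 0# → ∃[ j ] y j ≉ 0#
          y-nonzero (inj₁ x₁≉0) = 1 mod g , λ y≈0 → x₁≉0 (trans (sym (y⟨⟩ 1)) y≈0)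
          y-nonzero (inj₂ x₀≉0) = 0 mod g , λ y≈0 → x₀≉0 (trans (sym (y⟨⟩ 0)) y≈0)

      fixed⇒periodic : FixedVector → Σ[ y ∈ (Fin g → Carrier) ] Periodic y × (∃[ j ] y j ≉ 0#)
      fixed⇒periodic (x₁ , x₀ , nonzero , fix₁ , fix₀) = y fix₁ fix₀ , y-periodic fix₁ fix₀ , y-nonzero fix₁ fix₀ nonzero
        where open Unfold x₁ x₀

      solution⇒trace : (Σ[ z ∈ Vector Carrier size ] Solves ricci μ z × (∃[ j ] z (c j) ≉ 0#)) → trace (transfer g) ≈ fromℕ 2
      solution⇒trace (z , sol , nonzero) =
        periodic⇒trace (λ j → z (c j)) (solution⇒periodic _ (z , sol , λ _ → refl)) nonzero

      extend-nonzero : (y : Fin g → Carrier) → (∃[ j ] y j ≉ 0#) → (Σ[ z ∈ Vector Carrier size ] Solves ricci μ z × (∀ j → z (c j) ≈ y j)) →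
                       Σ[ z ∈ Vector Carrier size ] Solves ricci μ z × (∃[ j ] z (c j) ≉ 0#)
      extend-nonzero y (j , yj≉0) (z , sol , z≈y) = z , sol , j , λ zc≈0 → yj≉0 (trans (sym (z≈y j)) zc≈0)

      trace⇒solution : trace (transfer g) ≈ fromℕ 2 → Σ[ z ∈ Vector Carrier size ] Solves ricci μ z × (∃[ j ] z (c j) ≉ 0#)
      trace⇒solution tr≈2 = extend-nonzero (proj₁ periodic) (proj₂ (proj₂ periodic)) (periodic⇒solution (proj₁ periodic) (proj₁ (proj₂ periodic)))
        where
        periodic : Σ[ y ∈ (Fin g → Carrier) ] Periodic y × (∃[ j ] y j ≉ 0#)
        periodic = fixed⇒periodic (trace⇒fixed tr≈2)

theoremB : (ℝ : Reals) (G : Unicyclic) →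
  let open Reals ℝ
      open Unicyclic G
      open Ricci ℝ G
  in Balanced → (μ : Carrier) →
    -- (1)
    ((k : ℕ) → AvoidsTree (k mod g) μ →
      Eliminates (k mod g) μ ×
      (∃[ ψ ] feedback (k mod g) HasValue ψ At μ) ×
      (∀ ψ → feedback (k mod g) HasValue ψ At μ →
        ∀ z → SolvesOn (InTree (k mod g)) ricci μ z →
        σ z (v ⟨ k ⟩) ≈ ψ * (z (c ⟨ k ⟩) + z (c ⟨ suc k ⟩)))) ×
    ((∀ j → AvoidsTree j μ) →
      (Ψ : Fin g → Carrier) → (∀ j → feedback j HasValue Ψ j At μ) →
      let open Cycle μ Ψ in
      -- (2)
      ((y : Fin g → Carrier) →
        (∃[ z ] Solves ricci μ z × (∀ j → z (c j) ≈ y j)) ⇔ Periodic y) ×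
      -- (3)
      ((∀ k → P k ≉ 0#) →
        (∃[ z ] Solves ricci μ z × (∃[ j ] z (c j) ≉ 0#)) ⇔ trace (transfer g) ≈ fromℕ 2))
theoremB ℝ G _ μ =
  (λ k avoids → eliminates avoids , Response.feedback-regular k avoids , Response.feedback-σ k avoids) ,
  (λ avoids Ψ values → let open Reduction avoids Ψ values in
    (λ y → mk⇔ (solution⇒periodic y) (periodic⇒solution y)) ,
    (λ P≉0 → let open Transfer P≉0 in mk⇔ solution⇒trace trace⇒solution))
  where open CycleProblem ℝ G μ
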